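{- Let $G$ be a connected Eulerian digraph with $k$ vertices and Laplacian $L$. Let $G_n$ be the $n$-th cone over $G$ where $n\geq 2$. \begin{enumerate} \item Let $\mathbf{1}$ be the $k\times k$ matrix whose entries are all $1$, and let $I_k$ be the $k\times k$ identity matrix. Then \[ \operatorname{crit}(G_n)\simeq \left( \mathbb{Z}/(n+k)\mathbb{Z} \right)^{n-2}\oplus\operatorname{cok}(nI_k+L+\mathbf{1}). \] \item The group $\operatorname{cok}(nI_k+L+\mathbf{1})$ has a subgroup isomorphic to $\mathbb{Z}/(n+k)\mathbb{Z}$. \item The order of the critical group of $G_n$ is \[ |\operatorname{crit}(G_n)| =\frac{|p_L(-n)|}{n} (n+k)^{n-1} \] where $p_L$ is the characteristic polynomial of $L$. \end{enumerate}
   Context: $G$ is a connected Eulerian digraph (indegree equals outdegree at every vertex; undirected graphs are a special case; loops and multiple edges allowed) with finite vertex set $V$, $|V|=k$. The Laplacian $L\colon\mathbb{Z}V\to\mathbb{Z}V$ is given by $L(v)=\mathrm{outdeg}(v)\,v-\sum_{(v,w)\in E}w$; as a $k\times k$ matrix, $L=D-A^t$ with $D$ the diagonal matrix of outdegrees and $A$ the directed adjacency matrix. With $\delta\colon\mathbb{Z}V\to\mathbb{Z}$ the degree map $\delta(v)=1$, the critical group is $\operatorname{crit}(G)=\ker\delta/\operatorname{im}L$. The $n$-th iterated cone $G_n$ is the join of $G$ and the complete graph $K_n$, formed by connecting each vertex of $G$ to each vertex of $K_n$ by an undirected edge. $\operatorname{cok}(X)$ denotes the cokernel of the integer matrix $X$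 acting on $\mathbb{Z}^k$. -}

module Defs where

open import Level using (0ℓ)
open import Data.Nat as ℕ using (ℕ; zero; suc)
open import Data.Integer as ℤ using (ℤ; +_; _+_; _-_; _*_; -_)
open import Data.Integer.Properties using (+-identityˡ; +-identityʳ; +-assoc; +-comm; neg-distrib-+)
open import Data.Integer.Divisibility using (_∣_)
open import Data.Fin using (Fin; zero; suc; splitAt; punchIn; _≟_)
open import Data.Sum using (_⊎_; inj₁; inj₂)
open import Data.Product using (Σ; ∃; ∃-syntax; _×_; _,_; proj₁; proj₂)
open import Data.Bool using (if_then_else_)
open import Relation.Nullary.Decidable using (⌊_⌋)
open import Relation.Binary.PropositionalEquality using (_≡_; refl; cong; cong₂; trans; sym)
open import Relation.Binary.Construct.Closure.ReflexiveTransitive using (Star)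
open import Algebra.Bundles.Raw using (RawGroup)

∑ℕ : ∀ {m} → (Fin m → ℕ) → ℕ
∑ℕ {zero}  f = 0
∑ℕ {suc m} f = f zero ℕ.+ ∑ℕ (λ i → f (suc i))

∑ : ∀ {m} → (Fin m → ℤ) → ℤ
∑ {zero}  f = + 0
∑ {suc m} f = f zero + ∑ (λ i → f (suc i))

∑-+ : ∀ {m} (f g : Fin m → ℤ) → ∑ (λ i → f i + g i) ≡ ∑ f + ∑ g
∑-+ {zero} f g = refl
∑-+ {suc m} f g
  rewrite ∑-+ (λ i → f (suc i)) (λ i → g (suc i)) = swap4 (f zero) (g zero) (∑ (λ i → f (suc i))) (∑ (λ i → g (suc i)))
  where
  swap4 : ∀ a b c d → (a + b) + (c + d) ≡ (a + c) + (b + d)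
  swap4 a b c d = trans (+-assoc a b (c + d))
    (trans (cong (λ t → a + t) (trans (sym (+-assoc b c d)) (trans (cong (λ t → t + d) (+-comm b c)) (+-assoc c b d))))
      (sym (+-assoc a c (b + d))))

∑-neg : ∀ {m} (f : Fin m → ℤ) → ∑ (λ i → - f i) ≡ - ∑ f
∑-neg {zero} f = refl
∑-neg {suc m} f rewrite ∑-neg (λ i → f (suc i)) = sym (neg-distrib-+ (f zero) (∑ (λ i → f (suc i))))

Mat : ℕ → Set
Mat m = Fin m → Fin m → ℤ

_·_ : ∀ {m} → Mat m → (Fin m → ℤ) → (Fin m → ℤ)
(M · z) i = ∑ (λ j → M i j * z j)

δ : ∀ {m} → Fin m → Fin m → ℤ
δ i j = if ⌊ i ≟ j ⌋ then + 1 else + 0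

identity : ∀ {m} → Mat m
identity = δ

ones : ∀ {m} → Mat m
ones i j = + 1

sgn : ∀ {m} → Fin m → ℤ
sgn zero    = + 1
sgn (suc j) = - sgn j

det : ∀ {m} → Mat m → ℤ
det {zero}  M = + 1
det {suc m} M = ∑ (λ j → sgn j * M zero j * det (λ r c → M (suc r) (punchIn j c)))

charPolyAt : ∀ {m} → Mat m → ℤ → ℤ
charPolyAt M x = det (λ i j → x * δ i j - M i j)

-- Digraphs (multi-edges and loops allowed) on vertex set Fin m,
-- given by the adjacency matrix: A u v = number of edges u → v.

Digraph : ℕ → Set
Digraph m = Fin m → Fin m → ℕ

outdeg : ∀ {m} → Digraph m → Fin m → ℕ
outdeg A v = ∑ℕ (λ w → A v w)

indeg : ∀ {m} → Digraph m → Fin m → ℕ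
indeg A v = ∑ℕ (λ u → A u v)

Eulerian : ∀ {m} → Digraph m → Set
Eulerian A = ∀ v → indeg A v ≡ outdeg A v

Adjacent : ∀ {m} → Digraph m → Fin m → Fin m → Set
Adjacent A u v = (ℕ._<_ 0 (A u v)) ⊎ (ℕ._<_ 0 (A v u))

-- (weakly) connected; for Eulerian digraphs this is the same as strongly connected
Connected : ∀ {m} → Digraph m → Set
Connected A = ∀ u v → Star (Adjacent A) u v

-- Laplacian matrix L = D - Aᵗ  (column v is L(v) = outdeg(v) v - Σ_{(v,w)∈E} w)
Laplacian : ∀ {m} → Digraph m → Mat m
Laplacian A i j = (+ outdeg A i) * δ i j - + (A j i)

-- the join of G with K_n (n-th cone), vertex set Fin (m + n):
-- the first m vertices are those of G, the last n those of K_n;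
-- undirected edges are pairs of opposite directed edges.
cone : ∀ {m} → Digraph m → (n : ℕ) → Digraph (m ℕ.+ n)
cone {m} A n u v with splitAt m u | splitAt m v
... | inj₁ a | inj₁ b = A a b
... | inj₁ a | inj₂ b = 1
... | inj₂ a | inj₁ b = 1
... | inj₂ a | inj₂ b = if ⌊ a ≟ b ⌋ then 0 else 1

crit : ∀ {m} → Digraph m → RawGroup 0ℓ 0ℓ
crit {m} A = record
  { Carrier = Σ (Fin m → ℤ) (λ x → ∑ x ≡ + 0)
  ; _≈_ = λ x y → ∃[ z ] (∀ i → proj₁ x i - proj₁ y i ≡ (Laplacian A · z) i)
  ; _∙_ = λ x y → (λ i → proj₁ x i + proj₁ y i)
                , trans (∑-+ (proj₁ x) (proj₁ y)) (cong₂ _+_ (proj₂ x) (proj₂ y))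
  ; ε = (λ i → + 0) , ∑0 {m}
  ; _⁻¹ = λ x → (λ i → - proj₁ x i) , trans (∑-neg (proj₁ x)) (cong -_ (proj₂ x))
  }
  where
  ∑0 : ∀ {p} → ∑ {p} (λ i → + 0) ≡ + 0
  ∑0 {zero} = refl
  ∑0 {suc p} = trans (+-identityˡ _) (∑0 {p})

cok : ∀ {m} → Mat m → RawGroup 0ℓ 0ℓ
cok {m} M = record
  { Carrier = Fin m → ℤ
  ; _≈_ = λ x y → ∃[ z ] (∀ i → x i - y i ≡ (M · z) i)
  ; _∙_ = λ x y i → x i + y i
  ; ε = λ i → + 0
  ; _⁻¹ = λ x i → - x i
  }

ZModPow : ℕ → ℕ → RawGroup 0ℓ 0ℓ
ZModPow q r = record
  { Carrier = Fin r → ℤ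
  ; _≈_ = λ x y → ∀ i → (+ q) ∣ (x i - y i)
  ; _∙_ = λ x y i → x i + y i
  ; ε = λ i → + 0
  ; _⁻¹ = λ x i → - x i
  }

ZMod : ℕ → RawGroup 0ℓ 0ℓ
ZMod q = record
  { Carrier = ℤ
  ; _≈_ = λ x y → (+ q) ∣ (x - y)
  ; _∙_ = _+_
  ; ε = + 0
  ; _⁻¹ = -_
  }

HasOrder : RawGroup 0ℓ 0ℓ → ℕ → Set
HasOrder G N = Σ (Fin N → Carrier) λ e →
    (∀ i j → e i ≈ e j → i ≡ j) × (∀ x → ∃[ i ] (e i ≈ x))
  where open RawGroup G

{-# OPTIONS --safe #-}

-- Write the Laplacian of Gₙ in block form and a divisor of degree 0 as (a , b), a ∈ ℤᵏ, b ∈ ℤⁿ.  The map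
-- (a , b) ↦ ((bᵢ − b₀)_{i ≥ 2} , a − b₀ 𝟙) induces the isomorphism of part 1: adding multiples of the
-- kernel vector 𝟙 normalises a preimage, and b₁ is recovered from the degree.
-- Part 2 maps 1 to 𝟙.  By the maximum principle (n I + L) u = s 𝟙 forces u to be constant, and M 𝟙 = (n + k) 𝟙
-- for M = n I + L + J, so 𝟙 has order n + k in cok M.
-- Part 3 rests on |cok X| = |det X| for injective X: unimodular operations on adjacent columns clear the
-- first row, and one inducts on the size.  Consequently, injective matrices with equal images have equal |det|.
-- If X 𝟙 = s 𝟙, then X has the image of [s 𝟙 , X₁ , … , X_{k−1}], so |det X| = |s| |det [𝟙 , X₁ , … , X_{k−1}]|.
-- For X = M and X = C = − n I − L the bordered matrices [𝟙 , X₁ , …] have the same image because M + C = J,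
-- whence n |det M| = (n + k) |det C| = (n + k) |p_L(−n)|.

module Submission where

open import Defs
open import Algebra.Bundles.Raw using (RawGroup)
open import Algebra.Construct.DirectProduct using (rawGroup)
open import Algebra.Morphism.Structures using (module GroupMorphisms)
open import Data.Fin using (Fin; zero; suc; toℕ; fromℕ<; combine; remQuot; finToFun; funToFin; punchIn; punchOut; _↑ˡ_; _↑ʳ_; _≟_)
open import Data.Fin.Properties using (toℕ-injective; toℕ<n; toℕ-fromℕ<; remQuot-combine; combine-remQuot; funToFin-finToFin; finToFun-funToFin; injective⇒≤; punchInᵢ≢i; punchIn-punchOut; punchIn-injective; splitAt-↑ˡ; splitAt-↑ʳ)
open import Data.Integer as ℤ using (ℤ; +_; _+_; _-_; _*_; -_; ∣_∣)
open import Data.Integer.DivMod using (a≡a%n+[a/n]*n; n%d<d; _/_; _%_)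
import Data.Integer.Divisibility.Signed as Signed
open Signed using (∣ᵤ⇒∣; quotient)
open Signed._∣_ using (equality)
import Data.Integer.Properties as ℤₚ
open import Data.Integer.Tactic.RingSolver using (solve-∀)
open import Data.List using (List; []; _∷_; _++_; map)
open import Data.Nat using (ℕ; zero; suc; _^_; _≤_; _∸_; s≤s)
import Data.Nat as ℕ
import Data.Nat.Divisibility as ℕ∣
open import Data.Nat.Induction using (<-wellFounded)
import Data.Nat.Properties as ℕₚ
import Data.Nat.Tactic.RingSolver as ℕSolver
open import Data.Product using (Σ; ∃-syntax; _×_; _,_; proj₁; proj₂; map₁; uncurry)
open import Data.Sum using (inj₁; inj₂)
open import Data.Vec.Functional using () renaming (_∷_ to _∷ᵛ_; _++_ to _++ᵛ_)
open import Data.Vec.Functional.Properties using (lookup-++ˡ; lookup-++ʳ)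
open import Function using (_∘_)
open import Induction.WellFounded using (Acc; acc)
open import Level using (0ℓ)
open import Relation.Binary.PropositionalEquality
open import Relation.Nullary using (yes; no; contradiction)

-- Finite sums and images of integer matrices

∑-cong : ∀ {m} {f g : Fin m → ℤ} → (∀ i → f i ≡ g i) → ∑ f ≡ ∑ g
∑-cong {zero}  f≗g = refl
∑-cong {suc m} f≗g = cong₂ _+_ (f≗g zero) (∑-cong (λ i → f≗g (suc i)))

∑-const : ∀ m a → ∑ {m} (λ _ → a) ≡ + m * a
∑-const zero    a = sym (ℤₚ.*-zeroˡ a)
∑-const (suc m) a = trans (cong (λ t → a + t) (∑-const m a)) (sym (ℤₚ.suc-* (+ m) a))

∑-0 : ∀ {m} {f : Fin m → ℤ} → (∀ i → f i ≡ + 0) → ∑ f ≡ + 0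
∑-0 {m} f≗0 = trans (∑-cong f≗0) (trans (∑-const m (+ 0)) (ℤₚ.*-zeroʳ (+ m)))

∑-*ˡ : ∀ {m} a (f : Fin m → ℤ) → ∑ (λ i → a * f i) ≡ a * ∑ f
∑-*ˡ {zero}  a f = sym (ℤₚ.*-zeroʳ a)
∑-*ˡ {suc m} a f = trans (cong (λ t → a * f zero + t) (∑-*ˡ a (λ i → f (suc i))))
                         (sym (ℤₚ.*-distribˡ-+ a (f zero) _))

∑-*ʳ : ∀ {m} a (f : Fin m → ℤ) → ∑ (λ i → f i * a) ≡ ∑ f * a
∑-*ʳ a f = trans (∑-cong (λ i → ℤₚ.*-comm (f i) a)) (trans (∑-*ˡ a f) (ℤₚ.*-comm a (∑ f)))

∑-− : ∀ {m} (f g : Fin m → ℤ) → ∑ (λ i → f i - g i) ≡ ∑ f - ∑ g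
∑-− f g = trans (∑-+ f (λ i → - g i)) (cong (λ t → ∑ f + t) (∑-neg g))

∑-swap : ∀ {m n} (f : Fin m → Fin n → ℤ) → ∑ (λ i → ∑ (f i)) ≡ ∑ (λ j → ∑ (λ i → f i j))
∑-swap {zero} {n} f = sym (∑-0 {n} (λ _ → refl))
∑-swap {suc m} f = trans (cong (λ t → ∑ (f zero) + t) (∑-swap (λ i → f (suc i))))
                         (sym (∑-+ (f zero) (λ j → ∑ (λ i → f (suc i) j))))

∑-splitAt : ∀ m {n} (f : Fin (m ℕ.+ n) → ℤ) → ∑ f ≡ ∑ (λ i → f (i ↑ˡ n)) + ∑ (λ j → f (m ↑ʳ j))
∑-splitAt zero    f = sym (ℤₚ.+-identityˡ _)
∑-splitAt (suc m) f = trans (cong (λ t → f zero + t) (∑-splitAt m (λ i → f (suc i))))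
                            (sym (ℤₚ.+-assoc (f zero) _ _))

δ-suc : ∀ {m} (i j : Fin m) → δ (suc i) (suc j) ≡ δ i j
δ-suc i j with i ≟ j
... | yes _ = refl
... | no  _ = refl

∑-δ : ∀ {m} (i : Fin m) (f : Fin m → ℤ) → ∑ (λ j → δ i j * f j) ≡ f i
∑-δ {suc m} zero f =
  trans (cong₂ _+_ (ℤₚ.*-identityˡ (f zero)) (∑-0 (λ j → ℤₚ.*-zeroˡ (f (suc j)))))
        (ℤₚ.+-identityʳ (f zero))
∑-δ {suc m} (suc i) f =
  trans (cong₂ _+_ (ℤₚ.*-zeroˡ (f zero))
    (trans (∑-cong (λ j → cong (_* f (suc j)) (δ-suc i j))) (∑-δ i (λ j → f (suc j))))) (ℤₚ.+-identityˡ _)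

+∑ℕ : ∀ {m} (f : Fin m → ℕ) → + ∑ℕ f ≡ ∑ (λ i → + f i)
+∑ℕ {zero}  f = refl
+∑ℕ {suc m} f = trans (ℤₚ.pos-+ (f zero) _) (cong (λ t → + f zero + t) (+∑ℕ (λ i → f (suc i))))

·-congʳ : ∀ {m} (M : Mat m) {x y : Fin m → ℤ} → (∀ i → x i ≡ y i) → ∀ i → (M · x) i ≡ (M · y) i
·-congʳ M x≗y i = ∑-cong (λ j → cong (M i j *_) (x≗y j))

·-linear : ∀ {m} (M : Mat m) a b (x y : Fin m → ℤ) i →
           (M · (λ j → a * x j + b * y j)) i ≡ a * (M · x) i + b * (M · y) i
·-linear M a b x y i = begin
  ∑ (λ j → M i j * (a * x j + b * y j))               ≡⟨ ∑-cong (λ j → lemma a b (M i j) (x j) (y j)) ⟩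
  ∑ (λ j → a * (M i j * x j) + b * (M i j * y j))     ≡⟨ ∑-+ (λ j → a * (M i j * x j)) _ ⟩
  ∑ (λ j → a * (M i j * x j)) + ∑ (λ j → b * (M i j * y j))
    ≡⟨ cong₂ _+_ (∑-*ˡ a (λ j → M i j * x j)) (∑-*ˡ b (λ j → M i j * y j)) ⟩
  a * (M · x) i + b * (M · y) i                       ∎
  where
  open ≡-Reasoning
  lemma : ∀ a b m x y → m * (a * x + b * y) ≡ a * (m * x) + b * (m * y)
  lemma = solve-∀

·-neg : ∀ {m} (M : Mat m) (x : Fin m → ℤ) i → (M · (λ j → - x j)) i ≡ - (M · x) i
·-neg M x i = trans (∑-cong (λ j → sym (ℤₚ.neg-distribʳ-* (M i j) (x j)))) (∑-neg (λ j → M i j * x j))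

·-0 : ∀ {m} (M : Mat m) i → (M · (λ _ → + 0)) i ≡ + 0
·-0 M i = ∑-0 (λ j → ℤₚ.*-zeroʳ (M i j))

Im : ∀ {m} → Mat m → (Fin m → ℤ) → Set
Im M x = ∃[ z ] (∀ i → x i ≡ (M · z) i)

-- Vectors are functions compared pointwise; the hypothesis on `w` admits any pointwise presentation
-- of the combination without function extensionality.
Im-linear : ∀ {m} (M : Mat m) a b {x y w : Fin m → ℤ} → (∀ i → w i ≡ a * x i + b * y i) →
            Im M x → Im M y → Im M w
Im-linear M a b w≗ (z , x≗) (z′ , y≗) = (λ j → a * z j + b * z′ j) , λ i →
  trans (w≗ i) (trans (cong₂ (λ s t → a * s + b * t) (x≗ i) (y≗ i)) (sym (·-linear M a b z z′ i)))

Im-0 : ∀ {m} (M : Mat m) {x : Fin m → ℤ} → (∀ i → x i ≡ + 0) → Im M x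
Im-0 M x≗0 = (λ _ → + 0) , λ i → trans (x≗0 i) (sym (·-0 M i))

Im-resp : ∀ {m} (M : Mat m) {x y : Fin m → ℤ} → (∀ i → y i ≡ x i) → Im M x → Im M y
Im-resp M y≗x (z , x≗) = z , λ i → trans (y≗x i) (x≗ i)

Inj : ∀ {m} → Mat m → Set
Inj M = ∀ z → (∀ i → (M · z) i ≡ + 0) → ∀ i → z i ≡ + 0

-- Determinants under unimodular column operations

det-cong : ∀ {m} {M N : Mat m} → (∀ i j → M i j ≡ N i j) → det M ≡ det N
det-cong {zero}  M≗N = refl
det-cong {suc m} M≗N = ∑-cong (λ j →
  cong₂ (λ a d → sgn j * a * d) (M≗N zero j) (det-cong (λ r c → M≗N (suc r) (punchIn j c))))

-- Expand along row zero. In the term of column `p` the entry splits while the three minors agree,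
-- since they omit that column; in every other term the entries agree and the minors are linear in
-- column `p′` by induction.
det-linear : ∀ {m} (p : Fin m) a b (M N P : Mat m) →
             (∀ r → P r p ≡ a * M r p + b * N r p) →
             (∀ r c → c ≢ p → M r c ≡ P r c) → (∀ r c → c ≢ p → N r c ≡ P r c) →
             det P ≡ a * det M + b * det N
det-linear {suc m} p a b M N P P≗ M≗P N≗P = begin
  ∑ (λ j → sgn j * P zero j * minor P j)  ≡⟨ ∑-cong term ⟩
  ∑ (λ j → a * (sgn j * M zero j * minor M j) + b * (sgn j * N zero j * minor N j))
    ≡⟨ ∑-+ (λ j → a * (sgn j * M zero j * minor M j)) (λ j → b * (sgn j * N zero j * minor N j)) ⟩
  ∑ (λ j → a * (sgn j * M zero j * minor M j)) + ∑ (λ j → b * (sgn j * N zero j * minor N j))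
    ≡⟨ cong₂ _+_ (∑-*ˡ a (λ j → sgn j * M zero j * minor M j)) (∑-*ˡ b (λ j → sgn j * N zero j * minor N j)) ⟩
  a * det M + b * det N ∎
  where
  open ≡-Reasoning
  minor : Mat (suc m) → Fin (suc m) → ℤ
  minor X j = det (λ r c → X (suc r) (punchIn j c))

  at-p : ∀ s a b x y d → s * (a * x + b * y) * d ≡ a * (s * x * d) + b * (s * y * d)
  at-p = solve-∀
  off-p : ∀ s a b x d e → s * x * (a * d + b * e) ≡ a * (s * x * d) + b * (s * x * e)
  off-p = solve-∀

  term : ∀ j → sgn j * P zero j * minor P j ≡
               a * (sgn j * M zero j * minor M j) + b * (sgn j * N zero j * minor N j)
  term j with j ≟ p
  ... | yes refl = begin
    sgn j * P zero j * minor P j                              ≡⟨ cong (λ x → sgn j * x * minor P j) (P≗ zero) ⟩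
    sgn j * (a * M zero j + b * N zero j) * minor P j         ≡⟨ at-p (sgn j) a b (M zero j) (N zero j) (minor P j) ⟩
    a * (sgn j * M zero j * minor P j) + b * (sgn j * N zero j * minor P j)
      ≡⟨ cong₂ (λ d e → a * (sgn j * M zero j * d) + b * (sgn j * N zero j * e))
           (det-cong (λ r c → M≗P (suc r) (punchIn j c) (punchInᵢ≢i j c)))
           (det-cong (λ r c → N≗P (suc r) (punchIn j c) (punchInᵢ≢i j c))) ⟨
    a * (sgn j * M zero j * minor M j) + b * (sgn j * N zero j * minor N j) ∎
  ... | no j≢p = begin
    sgn j * P zero j * minor P j
      ≡⟨ cong (sgn j * P zero j *_) (det-linear p′ a b (λ r c → M (suc r) (punchIn j c)) (λ r c → N (suc r) (punchIn j c)) _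
           (λ r → subst (λ c → P (suc r) c ≡ a * M (suc r) c + b * N (suc r) c) (sym p≡) (P≗ (suc r)))
           (λ r c c≢p′ → M≗P (suc r) (punchIn j c) (avoid c≢p′))
           (λ r c c≢p′ → N≗P (suc r) (punchIn j c) (avoid c≢p′))) ⟩
    sgn j * P zero j * (a * minor M j + b * minor N j)        ≡⟨ off-p (sgn j) a b (P zero j) (minor M j) (minor N j) ⟩
    a * (sgn j * P zero j * minor M j) + b * (sgn j * P zero j * minor N j)
      ≡⟨ cong₂ (λ x y → a * (sgn j * x * minor M j) + b * (sgn j * y * minor N j)) (M≗P zero j j≢p) (N≗P zero j j≢p) ⟨
    a * (sgn j * M zero j * minor M j) + b * (sgn j * N zero j * minor N j) ∎
    where
    p′ = punchOut j≢p
    p≡ : punchIn j p′ ≡ p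
    p≡ = punchIn-punchOut j≢p
    avoid : ∀ {c} → c ≢ p′ → punchIn j c ≢ p
    avoid {c} c≢p′ e = c≢p′ (punchIn-injective j c p′ (trans e (sym p≡)))

-- A unimodular step of the Euclidean algorithm: for q = ⌊x / y⌋ the entries (x , y) become (y , − (x mod y)).
pivot : ∀ {m} → Fin m → ℤ → (Fin (suc m) → ℤ) → (Fin (suc m) → ℤ)
pivot zero    q v zero          = v (suc zero)
pivot zero    q v (suc zero)    = q * v (suc zero) - v zero
pivot zero    q v (suc (suc c)) = v (suc (suc c))
pivot (suc i) q v zero          = v zero
pivot (suc i) q v (suc c)       = pivot i q (v ∘ suc) c

-- Transpose of the column operation: the coefficients over the old columns that give the same
-- combination as `z` over the new ones.
pivotᵀ : ∀ {m} → Fin m → ℤ → (Fin (suc m) → ℤ) → (Fin (suc m) → ℤ)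
pivotᵀ zero    q z zero          = - z (suc zero)
pivotᵀ zero    q z (suc zero)    = z zero + q * z (suc zero)
pivotᵀ zero    q z (suc (suc c)) = z (suc (suc c))
pivotᵀ (suc i) q z zero          = z zero
pivotᵀ (suc i) q z (suc c)       = pivotᵀ i q (z ∘ suc) c

-- Inverse of `pivotᵀ`: translates coefficients over the old columns into coefficients over the new
-- ones. Cofactors transform in the same way.
pivot⁻ᵀ : ∀ {m} → Fin m → ℤ → (Fin (suc m) → ℤ) → (Fin (suc m) → ℤ)
pivot⁻ᵀ zero    q z zero          = q * z zero + z (suc zero)
pivot⁻ᵀ zero    q z (suc zero)    = - z zero
pivot⁻ᵀ zero    q z (suc (suc c)) = z (suc (suc c))
pivot⁻ᵀ (suc i) q z zero          = z zero
pivot⁻ᵀ (suc i) q z (suc c)       = pivot⁻ᵀ i q (z ∘ suc) c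

pivot-adjoint : ∀ {m} (i : Fin m) q v z → ∑ (λ j → pivot i q v j * z j) ≡ ∑ (λ j → v j * pivotᵀ i q z j)
pivot-adjoint zero q v z = lemma q (v zero) (v (suc zero)) (z zero) (z (suc zero)) (∑ (λ j → v (suc (suc j)) * z (suc (suc j))))
  where
  lemma : ∀ q x y a b s → y * a + ((q * y - x) * b + s) ≡ x * - b + (y * (a + q * b) + s)
  lemma = solve-∀
pivot-adjoint (suc i) q v z = cong (λ t → v zero * z zero + t) (pivot-adjoint i q (v ∘ suc) (z ∘ suc))

pivot-isometry : ∀ {m} (i : Fin m) q v z → ∑ (λ j → pivot i q v j * pivot⁻ᵀ i q z j) ≡ ∑ (λ j → v j * z j)
pivot-isometry zero q v z = lemma q (v zero) (v (suc zero)) (z zero) (z (suc zero)) (∑ (λ j → v (suc (suc j)) * z (suc (suc j))))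
  where
  lemma : ∀ q x y a b s → y * (q * a + b) + ((q * y - x) * - a + s) ≡ x * a + (y * b + s)
  lemma = solve-∀
pivot-isometry (suc i) q v z = cong (λ t → v zero * z zero + t) (pivot-isometry i q (v ∘ suc) (z ∘ suc))

pivotᵀ-injective : ∀ {m} (i : Fin m) q z → (∀ c → pivotᵀ i q z c ≡ + 0) → ∀ c → z c ≡ + 0
pivotᵀ-injective zero q z z≗0 (suc zero) = ℤₚ.neg-injective (z≗0 zero)
pivotᵀ-injective zero q z z≗0 zero = trans (lemma (z zero) q (z (suc zero)))
  (trans (cong₂ (λ s t → s - q * t) (z≗0 (suc zero)) (pivotᵀ-injective zero q z z≗0 (suc zero))) (zero-arith q))
  where
  lemma : ∀ x q y → x ≡ (x + q * y) - q * y
  lemma = solve-∀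
  zero-arith : ∀ q → + 0 - q * + 0 ≡ + 0
  zero-arith = solve-∀
pivotᵀ-injective zero    q z z≗0 (suc (suc c)) = z≗0 (suc (suc c))
pivotᵀ-injective (suc i) q z z≗0 zero          = z≗0 zero
pivotᵀ-injective (suc i) q z z≗0 (suc c)       = pivotᵀ-injective i q (z ∘ suc) (z≗0 ∘ suc) c

-- How deleting column j interacts with a pivot on columns i, i + 1: j is
-- neither of them, or j = i (with j′ = i + 1), or j = i + 1 (with j′ = i).
data Deletion {m} (i : Fin (suc m)) (q : ℤ) (j : Fin (suc (suc m))) : Set where
  apart : (i′ : Fin m) →
          (∀ v c → pivot i q v (punchIn j c) ≡ pivot i′ q (v ∘ punchIn j) c) →
          (∀ z → pivot⁻ᵀ i q z j ≡ z j) → Deletion i q j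
  first : (j′ : Fin (suc (suc m))) (p : Fin (suc m)) → sgn j′ ≡ - sgn j →
          (∀ v → pivot i q v (punchIn j p) ≡ q * v (punchIn j p) - v (punchIn j′ p)) →
          (∀ v c → c ≢ p → v (punchIn j c) ≡ pivot i q v (punchIn j c)) →
          (∀ v c → c ≢ p → v (punchIn j′ c) ≡ pivot i q v (punchIn j c)) →
          (∀ z → pivot⁻ᵀ i q z j ≡ q * z j + z j′) → Deletion i q j
  second : (j′ : Fin (suc (suc m))) → sgn j′ ≡ - sgn j →
          (∀ v c → pivot i q v (punchIn j c) ≡ v (punchIn j′ c)) →
          (∀ z → pivot⁻ᵀ i q z j ≡ - z j′) → Deletion i q j

deletion : ∀ {m} (i : Fin (suc m)) q j → Deletion i q j
deletion zero q zero = first (suc zero) zero refl (λ v → refl)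
  (λ { v zero c≢0 → contradiction refl c≢0 ; v (suc c) c≢0 → refl })
  (λ { v zero c≢0 → contradiction refl c≢0 ; v (suc c) c≢0 → refl })
  (λ z → refl)
deletion zero q (suc zero) = second zero refl (λ { v zero → refl ; v (suc c) → refl }) (λ z → refl)
deletion {suc m} zero q (suc (suc j)) = apart zero
  (λ { v zero → refl ; v (suc zero) → refl ; v (suc (suc c)) → refl }) (λ z → refl)
deletion {suc m} (suc i) q zero = apart i (λ v c → refl) (λ z → refl)
deletion {suc m} (suc i) q (suc j) with deletion i q j
... | apart i′ rows dual = apart (suc i′)
        (λ { v zero → refl ; v (suc c) → rows (v ∘ suc) c }) (λ z → dual (z ∘ suc))
... | first j′ p sign at off off′ dual = first (suc j′) (suc p) (cong -_ sign) (λ v → at (v ∘ suc))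
        (λ { v zero _ → refl ; v (suc c) c≢p → off (v ∘ suc) c (c≢p ∘ cong suc) })
        (λ { v zero _ → refl ; v (suc c) c≢p → off′ (v ∘ suc) c (c≢p ∘ cong suc) })
        (λ z → dual (z ∘ suc))
... | second j′ sign rows dual = second (suc j′) (cong -_ sign)
        (λ { v zero → refl ; v (suc c) → rows (v ∘ suc) c }) (λ z → dual (z ∘ suc))

-- The entries of row zero transform by `pivot` and their cofactors by `pivot⁻ᵀ`, so the dot product
-- is preserved by `pivot-isometry`. The cases of `Deletion` compute the new cofactors: by
-- induction, by linearity in one column, or by the sign change between neighbouring columns.
det-pivot : ∀ {m} (i : Fin m) q (M : Mat (suc m)) → det (λ r → pivot i q (M r)) ≡ det M
det-pivot {suc m} i q M = begin
  ∑ (λ j → sgn j * pivot i q (M zero) j * minor′ j)         ≡⟨ ∑-cong term ⟩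
  ∑ (λ j → pivot i q (M zero) j * pivot⁻ᵀ i q cofactor j)   ≡⟨ pivot-isometry i q (M zero) cofactor ⟩
  ∑ (λ j → M zero j * cofactor j)                           ≡⟨ ∑-cong (λ j → rearrange (M zero j) (sgn j) (minor j)) ⟩
  det M                                                     ∎
  where
  open ≡-Reasoning
  minor minor′ cofactor : Fin (suc (suc m)) → ℤ
  minor j = det (λ r c → M (suc r) (punchIn j c))
  minor′ j = det (λ r c → pivot i q (M (suc r)) (punchIn j c))
  cofactor j = sgn j * minor j

  rearrange : ∀ x s d → x * (s * d) ≡ s * x * d
  rearrange = solve-∀
  first-arith : ∀ q s d e → s * (q * d + - (+ 1) * e) ≡ q * (s * d) + (- s) * e
  first-arith = solve-∀
  second-arith : ∀ s d → s * d ≡ - (- s * d)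
  second-arith = solve-∀
  minus-arith : ∀ q x y → q * x - y ≡ q * x + - (+ 1) * y
  minus-arith = solve-∀

  cofactor′ : ∀ j → sgn j * minor′ j ≡ pivot⁻ᵀ i q cofactor j
  cofactor′ j with deletion i q j
  ... | apart i′ rows dual = trans
    (cong (sgn j *_) (trans (det-cong (λ r → rows (M (suc r)))) (det-pivot i′ q (λ r c → M (suc r) (punchIn j c)))))
    (sym (dual cofactor))
  ... | first j′ p sign at off off′ dual = begin
    sgn j * minor′ j
      ≡⟨ cong (sgn j *_) (det-linear p q (- (+ 1)) (λ r c → M (suc r) (punchIn j c)) (λ r c → M (suc r) (punchIn j′ c)) _
           (λ r → trans (at (M (suc r))) (minus-arith q _ _))
           (λ r → off (M (suc r))) (λ r → off′ (M (suc r)))) ⟩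
    sgn j * (q * minor j + - (+ 1) * minor j′)     ≡⟨ first-arith q (sgn j) (minor j) (minor j′) ⟩
    q * cofactor j + (- sgn j) * minor j′          ≡⟨ cong (λ s → q * cofactor j + s * minor j′) sign ⟨
    q * cofactor j + cofactor j′                   ≡⟨ dual cofactor ⟨
    pivot⁻ᵀ i q cofactor j                         ∎
  ... | second j′ sign rows dual = begin
    sgn j * minor′ j           ≡⟨ cong (sgn j *_) (det-cong (λ r → rows (M (suc r)))) ⟩
    sgn j * minor j′           ≡⟨ second-arith (sgn j) (minor j′) ⟩
    - (- sgn j * minor j′)     ≡⟨ cong (λ s → - (s * minor j′)) sign ⟨
    - cofactor j′              ≡⟨ dual cofactor ⟨
    pivot⁻ᵀ i q cofactor j     ∎

  term : ∀ j → sgn j * pivot i q (M zero) j * minor′ j ≡ pivot i q (M zero) j * pivot⁻ᵀ i q cofactor j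
  term j = trans (sym (rearrange (pivot i q (M zero) j) (sgn j) (minor′ j)))
                 (cong (pivot i q (M zero) j *_) (cofactor′ j))

-- Clearing a row by unimodular column operations

pivots : ∀ {m} → List (Fin m × ℤ) → (Fin (suc m) → ℤ) → (Fin (suc m) → ℤ)
pivots []              v = v
pivots ((i , q) ∷ ops) v = pivots ops (pivot i q v)

pivots-++ : ∀ {m} (ops ops′ : List (Fin m × ℤ)) v → pivots (ops ++ ops′) v ≡ pivots ops′ (pivots ops v)
pivots-++ []        ops′ v = refl
pivots-++ (o ∷ ops) ops′ v = pivots-++ ops ops′ _

pivots-suc : ∀ {m} (ops : List (Fin m × ℤ)) v c → pivots (map (map₁ suc) ops) v (suc c) ≡ pivots ops (v ∘ suc) c
pivots-suc []              v c = refl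
pivots-suc ((i , q) ∷ ops) v c = pivots-suc ops (pivot (suc i) q v) c

-- Each pivot turns the entry at index one into a negated remainder modulo its former value, so its
-- absolute value drops; the entries beyond it stay zero.
euclid : ∀ {m} (v : Fin (suc (suc m)) → ℤ) → (∀ c → v (suc (suc c)) ≡ + 0) → Acc ℕ._<_ ∣ v (suc zero) ∣ →
         ∃[ ops ] (∀ c → pivots ops v (suc c) ≡ + 0)
euclid v v≗0 (acc rec) with v (suc zero) ℤ.≟ + 0
... | yes v₁≡0 = [] , λ { zero → v₁≡0 ; (suc c) → v≗0 c }
... | no v₁≢0 = let ops , cleared = euclid (pivot zero q v) v≗0 (rec smaller) in (zero , q) ∷ ops , cleared
  where
  instance
    v₁-nonZero : ℤ.NonZero (v (suc zero))
    v₁-nonZero = ℤ.≢-nonZero v₁≢0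
  q = v zero / v (suc zero)
  r = v zero % v (suc zero)
  lemma : ∀ r q y → q * y - (r + q * y) ≡ - r
  lemma = solve-∀
  remainder : q * v (suc zero) - v zero ≡ - + r
  remainder = trans (cong (λ x → q * v (suc zero) - x) (a≡a%n+[a/n]*n (v zero) (v (suc zero))))
                    (lemma (+ r) q (v (suc zero)))
  smaller : ∣ q * v (suc zero) - v zero ∣ ℕ.< ∣ v (suc zero) ∣
  smaller = subst (ℕ._< ∣ v (suc zero) ∣) (sym (trans (cong ∣_∣ remainder) (ℤₚ.∣-i∣≡∣i∣ (+ r))))
                  (n%d<d (v zero) (v (suc zero)))

-- The tail is cleared recursively down to its first entry; the shifted operations leave index zero
-- alone, and `euclid` then merges the two surviving entries.
clear : ∀ {m} (v : Fin (suc m) → ℤ) → ∃[ ops ] (∀ c → pivots ops v (suc c) ≡ + 0)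
clear {zero}  v = [] , λ ()
clear {suc m} v =
  let ops  , cleared  = clear (v ∘ suc)
      ops₁ = map (map₁ suc) ops
      ops₂ , cleared₂ = euclid (pivots ops₁ v) (λ c → trans (pivots-suc ops v (suc c)) (cleared c)) (<-wellFounded _)
  in ops₁ ++ ops₂ , λ c → trans (cong (λ w → w (suc c)) (pivots-++ ops₁ ops₂ v)) (cleared₂ c)

-- The traces of column equivalence that let injectivity pass to the cleared matrix and the order of
-- the cokernel pass back.
record _≃_ {m} (M N : Mat m) : Set where
  field
    det≡ : det N ≡ det M
    to   : ∀ {x} → Im M x → Im N x
    from : ∀ {x} → Im N x → Im M x
    inj  : Inj M → Inj N

pivot-≃ : ∀ {m} (i : Fin m) q (M : Mat (suc m)) → M ≃ (λ r → pivot i q (M r))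
pivot-≃ i q M = record
  { det≡ = det-pivot i q M
  ; to   = λ (z , x≗) → pivot⁻ᵀ i q z , λ r → trans (x≗ r) (sym (pivot-isometry i q (M r) z))
  ; from = λ (z , x≗) → pivotᵀ i q z , λ r → trans (x≗ r) (pivot-adjoint i q (M r) z)
  ; inj  = λ M-inj z Nz≗0 → pivotᵀ-injective i q z (M-inj (pivotᵀ i q z)
             (λ r → trans (sym (pivot-adjoint i q (M r) z)) (Nz≗0 r)))
  }

pivots-≃ : ∀ {m} ops (M : Mat (suc m)) → M ≃ (λ r → pivots ops (M r))
pivots-≃ [] M = record { det≡ = refl ; to = λ x → x ; from = λ x → x ; inj = λ x → x }
pivots-≃ ((i , q) ∷ ops) M = record
  { det≡ = trans R.det≡ P.det≡ ; to = R.to ∘ P.to ; from = P.from ∘ R.from ; inj = R.inj ∘ P.inj }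
  where
  module P = _≃_ (pivot-≃ i q M)
  module R = _≃_ (pivots-≃ ops (λ r → pivot i q (M r)))

-- Orders of cokernels

*-≡0 : ∀ {i j} → i ≢ + 0 → i * j ≡ + 0 → j ≡ + 0
*-≡0 {i} i≢0 ij≡0 with ℤₚ.i*j≡0⇒i≡0∨j≡0 i ij≡0
... | inj₁ i≡0 = contradiction i≡0 i≢0
... | inj₂ j≡0 = j≡0

-- The two representatives differ by less than `n` in absolute value, and zero is the only such
-- multiple of `n`.
residue-unique : ∀ {n} (a b : Fin n) → n ℕ∣.∣ ∣ + toℕ a - + toℕ b ∣ → a ≡ b
residue-unique {n} a b n∣a-b with ∣ + toℕ a - + toℕ b ∣ in eq
... | zero  = toℕ-injective (ℤₚ.+-injective (ℤₚ.i-j≡0⇒i≡j (+ toℕ a) (+ toℕ b) (ℤₚ.∣i∣≡0⇒i≡0 eq)))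
... | suc x = contradiction (ℕ∣.∣⇒≤ n∣a-b) (ℕₚ.<⇒≱ (subst (ℕ._< n) eq small))
  where
  small : ∣ + toℕ a - + toℕ b ∣ ℕ.< n
  small = ℕₚ.≤-<-trans
    (subst (λ i → ∣ i ∣ ℕ.≤ toℕ a ℕ.⊔ toℕ b) (sym (ℤₚ.[+m]-[+n]≡m⊖n (toℕ a) (toℕ b))) (ℤₚ.∣m⊝n∣≤m⊔n (toℕ a) (toℕ b)))
    (ℕₚ.⊔-lub (toℕ<n a) (toℕ<n b))

residue : ∀ d .{{_ : ℤ.NonZero d}} x → ∃[ a ] ∃[ z ] (+ toℕ {∣ d ∣} a - x ≡ d * z)
residue d x = fromℕ< (n%d<d x d) , - (x / d) , (begin
  + toℕ (fromℕ< (n%d<d x d)) - x              ≡⟨ cong (λ r → + r - x) (toℕ-fromℕ< (n%d<d x d)) ⟩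
  + (x % d) - x                               ≡⟨ cong (λ t → + (x % d) - t) (a≡a%n+[a/n]*n x d) ⟩
  + (x % d) - (+ (x % d) + (x / d) * d)       ≡⟨ lemma (+ (x % d)) (x / d) d ⟩
  d * - (x / d)                               ∎)
  where
  open ≡-Reasoning
  lemma : ∀ r q d → r - (r + q * d) ≡ d * - q
  lemma = solve-∀

≡*⇒∣ : ∀ {d x z} → x ≡ d * z → ∣ d ∣ ℕ∣.∣ ∣ x ∣
≡*⇒∣ {d} {z = z} refl = ℕ∣.divides ∣ z ∣ (trans (ℤₚ.∣i*j∣≡∣i∣*∣j∣ d z) (ℕₚ.*-comm ∣ d ∣ ∣ z ∣))

remQuot-injective : ∀ {m} n (i j : Fin (m ℕ.* n)) → remQuot {m} n i ≡ remQuot n j → i ≡ j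
remQuot-injective {m} n i j eq =
  trans (sym (combine-remQuot {m} n i)) (trans (cong (uncurry combine) eq) (combine-remQuot {m} n j))

funToFin-cong : ∀ {m n} {f g : Fin m → Fin n} → (∀ i → f i ≡ g i) → funToFin f ≡ funToFin g
funToFin-cong {zero}  f≗g = refl
funToFin-cong {suc m} f≗g = cong₂ combine (f≗g zero) (funToFin-cong (f≗g ∘ suc))

ZModPow-order : ∀ q .{{_ : ℕ.NonZero q}} r → HasOrder (ZModPow q r) (q ^ r)
ZModPow-order q r = (λ i c → + toℕ (finToFun {q} {r} i c)) , injective , surjective
  where
  injective : ∀ i j → (∀ c → q ℕ∣.∣ ∣ + toℕ (finToFun {q} {r} i c) - + toℕ (finToFun {q} {r} j c) ∣) → i ≡ j
  injective i j i≈j = trans (sym (funToFin-finToFin {r} {q} i))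
    (trans (funToFin-cong (λ c → residue-unique (finToFun {q} {r} i c) (finToFun j c) (i≈j c))) (funToFin-finToFin {r} {q} j))
  surjective : ∀ x → ∃[ i ] (∀ c → q ℕ∣.∣ ∣ + toℕ (finToFun {q} {r} i c) - x c ∣)
  surjective x = funToFin rep , λ c →
    subst (λ a → q ℕ∣.∣ ∣ + toℕ a - x c ∣) (sym (finToFun-funToFin rep c)) (≡*⇒∣ {+ q} {z = proj₁ (proj₂ (residue (+ q) (x c)))} (proj₂ (proj₂ (residue (+ q) (x c)))))
    where
    rep : Fin r → Fin q
    rep c = proj₁ (residue (+ q) (x c))

×-order : ∀ {G H : RawGroup 0ℓ 0ℓ} {a b} → HasOrder G a → HasOrder H b → HasOrder (rawGroup G H) (a ℕ.* b)
×-order {G} {H} {a} {b} (e , e-inj , e-surj) (f , f-inj , f-surj) =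
  (λ i → e (proj₁ (remQuot {a} b i)) , f (proj₂ (remQuot {a} b i))) ,
  (λ i j (p , q) → remQuot-injective b i j (cong₂ _,_ (e-inj _ _ p) (f-inj _ _ q))) ,
  (λ (x , y) → let i , p = e-surj x ; j , q = f-surj y in
     combine i j , subst (λ ij → G._≈_ (e (proj₁ ij)) x × H._≈_ (f (proj₂ ij)) y) (sym (remQuot-combine i j)) (p , q))
  where
  module G = RawGroup G
  module H = RawGroup H

-- Send each representative modulo `M` to the index of its class modulo `N`. Equal indices put the
-- difference in the smaller image, hence in `Im M`, so this map of finite sets is injective.
cok-order-≤ : ∀ {m} {M N : Mat m} {a b} → (∀ {x} → Im N x → Im M x) →
              HasOrder (cok M) a → HasOrder (cok N) b → a ℕ.≤ b
cok-order-≤ {M = M} {N} N⊆M (e , e-inj , _) (f , _ , f-surj) = injective⇒≤ {f = λ i → proj₁ (f-surj (e i))} injective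
  where
  lemma : ∀ x y w → x - y ≡ - (+ 1) * (w - x) + + 1 * (w - y)
  lemma = solve-∀
  injective : ∀ {i j} → proj₁ (f-surj (e i)) ≡ proj₁ (f-surj (e j)) → i ≡ j
  injective {i} {j} eq = e-inj i j (N⊆M (Im-linear N (- (+ 1)) (+ 1)
    (λ c → lemma (e i c) (e j c) (f (proj₁ (f-surj (e i))) c))
    (proj₂ (f-surj (e i)))
    (subst (λ k → Im N (λ c → f k c - e j c)) (sym eq) (proj₂ (f-surj (e j))))))

-- Constructively, an exponent of the cokernel is what rules out a zero pivot.
record FiniteCok {m} (M : Mat m) : Set where
  field
    order      : HasOrder (cok M) ∣ det M ∣
    exponent   : ℤ
    exponent≢0 : exponent ≢ + 0
    exponent-* : ∀ (x : Fin m → ℤ) → Im M (λ i → exponent * x i)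

-- `N` is block lower triangular: row zero is `(d , 0 , … , 0)`, and below it `N′` acts, shifted by
-- multiples of the first column.
module Block {m} (N : Mat (suc m)) (cleared : ∀ c → N zero (suc c) ≡ + 0) where

  d : ℤ
  d = N zero zero

  N′ : Mat m
  N′ r c = N (suc r) (suc c)

  row₀ : ∀ z → (N · z) zero ≡ d * z zero
  row₀ z = trans (cong (λ t → d * z zero + t)
                   (∑-0 (λ c → trans (cong (_* z (suc c)) (cleared c)) (ℤₚ.*-zeroˡ (z (suc c))))))
                 (ℤₚ.+-identityʳ (d * z zero))

  det≡ : det N ≡ d * det N′
  det≡ = trans (cong₂ _+_ (cong (_* det N′) (ℤₚ.*-identityˡ d))
                 (∑-0 (λ c → trans (cong (λ t → sgn (suc c) * t * minor c) (cleared c)) (lemma (sgn (suc c)) (minor c)))))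
               (ℤₚ.+-identityʳ (d * det N′))
    where
    minor : Fin m → ℤ
    minor j = det (λ r c → N (suc r) (punchIn (suc j) c))
    lemma : ∀ s x → s * + 0 * x ≡ + 0
    lemma = solve-∀

  N′-inj : Inj N → Inj N′
  N′-inj N-inj z N′z≗0 i = N-inj (+ 0 ∷ᵛ z)
    (λ { zero    → trans (row₀ (+ 0 ∷ᵛ z)) (ℤₚ.*-zeroʳ d)
       ; (suc r) → cong₂ _+_ (ℤₚ.*-zeroʳ (N (suc r) zero)) (N′z≗0 r) })
    (suc i)

  finiteCok : Inj N → FiniteCok N′ → FiniteCok N
  finiteCok N-inj F = record
    { order      = subst (HasOrder (cok N)) (sym (trans (cong ∣_∣ det≡) (ℤₚ.∣i*j∣≡∣i∣*∣j∣ d (det N′))))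
                     (enum , enum-inj , enum-surj)
    ; exponent   = e * d
    ; exponent≢0 = λ ed≡0 → d≢0 (*-≡0 F.exponent≢0 ed≡0)
    ; exponent-* = λ x →
        -- Coordinate zero takes the coefficient `e * x zero`; the contribution of the first column
        -- is subtracted in advance, so `N′` has to reach only `e` times a vector.
        let z , N′z≗ = F.exponent-* (λ r → d * x (suc r) - N (suc r) zero * x zero)
        in e * x zero ∷ᵛ z ,
           λ { zero    → trans (exp₀ e d (x zero)) (sym (row₀ (e * x zero ∷ᵛ z)))
             ; (suc r) → trans (expₛ e d (N (suc r) zero) (x zero) (x (suc r)))
                           (cong (λ t → N (suc r) zero * (e * x zero) + t) (N′z≗ r)) }
    }
    where
    module F = FiniteCok F
    e = F.exponent

    exp₀ : ∀ e d x → e * d * x ≡ d * (e * x)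
    exp₀ = solve-∀
    expₛ : ∀ e d c x y → e * d * y ≡ c * (e * x) + e * (d * y - c * x)
    expₛ = solve-∀

    -- If `d` vanished, `e` times the first column below it would equal `N′ · z`, so that `e`
    -- followed by `- z` would be a kernel vector; injectivity would then force `e` to be zero.
    d≢0 : d ≢ + 0
    d≢0 d≡0 = F.exponent≢0 (N-inj (e ∷ᵛ (λ j → - z j))
      (λ { zero    → trans (row₀ (e ∷ᵛ (λ j → - z j))) (trans (cong (_* e) d≡0) (ℤₚ.*-zeroˡ e))
         ; (suc r) → trans (cong (λ t → N (suc r) zero * e + t)
                              (trans (·-neg N′ z r) (cong -_ (sym (N′z≗ r)))))
                           (cancel (N (suc r) zero) e) })
      zero)
      where
      cancel : ∀ c e → c * e + - (e * c) ≡ + 0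
      cancel = solve-∀
      z = proj₁ (F.exponent-* (λ r → N (suc r) zero))
      N′z≗ = proj₂ (F.exponent-* (λ r → N (suc r) zero))

    instance
      d-nonZero : ℤ.NonZero d
      d-nonZero = ℤ.≢-nonZero d≢0

    enum′ = proj₁ F.order

    pair : Fin ∣ d ∣ × Fin ∣ det N′ ∣ → Fin (suc m) → ℤ
    pair (a , b) = + toℕ a ∷ᵛ enum′ b

    enum : Fin (∣ d ∣ ℕ.* ∣ det N′ ∣) → Fin (suc m) → ℤ
    enum i = pair (remQuot {∣ d ∣} ∣ det N′ ∣ i)

    -- Coordinate zero determines `a` modulo `d`. Once `a` and `a′` coincide, the coefficient
    -- `z zero` vanishes, and the remaining coordinates compare `b` with `b′` modulo `N′`.
    pair-inj : ∀ p q → Im N (λ c → pair p c - pair q c) → p ≡ q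
    pair-inj (a , b) (a′ , b′) (z , p-q≗) with residue-unique a a′ (≡*⇒∣ {d} {z = z zero} (trans (p-q≗ zero) (row₀ z)))
    ... | refl = cong (a ,_) (proj₁ (proj₂ F.order) b b′ (z ∘ suc , λ r → trans (p-q≗ (suc r))
            (trans (cong (λ t → N (suc r) zero * t + (N′ · (z ∘ suc)) r) z₀≡0)
              (trans (cong (_+ (N′ · (z ∘ suc)) r) (ℤₚ.*-zeroʳ (N (suc r) zero))) (ℤₚ.+-identityˡ _)))))
      where
      z₀≡0 : z zero ≡ + 0
      z₀≡0 = *-≡0 d≢0 (trans (sym (trans (p-q≗ zero) (row₀ z))) (ℤₚ.+-inverseʳ (+ toℕ a)))

    enum-inj : ∀ i j → Im N (λ c → enum i c - enum j c) → i ≡ j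
    enum-inj i j i≈j = remQuot-injective ∣ det N′ ∣ i j (pair-inj _ _ i≈j)

    enum-surj : ∀ x → ∃[ i ] Im N (λ c → enum i c - x c)
    enum-surj x =
      let a , z₀ , a-x≡ = residue d (x zero)
          -- The multiple `z₀` of the first column spent on reducing `x zero` shifts the other
          -- coordinates; the shift is compensated before they are reduced modulo `N′`.
          b , z  , b-x≗ = proj₂ (proj₂ F.order) (λ r → x (suc r) + N (suc r) zero * z₀)
      in combine a b , subst (λ p → Im N (λ c → pair p c - x c)) (sym (remQuot-combine a b))
         (z₀ ∷ᵛ z , λ { zero    → trans a-x≡ (sym (row₀ (z₀ ∷ᵛ z)))
                      ; (suc r) → trans (shift (enum′ b r) (x (suc r)) (N (suc r) zero * z₀))
                                    (cong (λ t → N (suc r) zero * z₀ + t) (b-x≗ r)) })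
      where
      shift : ∀ b x c → b - x ≡ c + (b - (x + c))
      shift = solve-∀

-- Induction on the size: clear row zero, apply `Block` to the smaller matrix, and carry the
-- enumeration back along the equality of images. The empty matrix has determinant one and a trivial
-- cokernel.
finiteCok : ∀ {m} (M : Mat m) → Inj M → FiniteCok M
finiteCok {zero} M M-inj = record
  { order      = (λ _ ()) , (λ { zero zero _ → refl }) , (λ x → zero , (λ ()) , λ ())
  ; exponent   = + 1
  ; exponent≢0 = λ ()
  ; exponent-* = λ x → (λ ()) , λ ()
  }
finiteCok {suc m} M M-inj = record
  { order      = let f , f-inj , f-surj = F.order in
                 subst (λ a → HasOrder (cok M) ∣ a ∣) E.det≡
                   (f , (λ i j p → f-inj i j (E.to p)) , (λ x → let i , p = f-surj x in i , E.from p))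
  ; exponent   = F.exponent
  ; exponent≢0 = F.exponent≢0
  ; exponent-* = λ x → E.from (F.exponent-* x)
  }
  where
  ops = proj₁ (clear (M zero))
  N : Mat (suc m)
  N r = pivots ops (M r)
  module E = _≃_ (pivots-≃ ops M)
  module B = Block N (proj₂ (clear (M zero)))
  module F = FiniteCok (B.finiteCok (E.inj M-inj) (finiteCok B.N′ (B.N′-inj (E.inj M-inj))))

∣det∣-image : ∀ {m} {M N : Mat m} → Inj M → Inj N → (∀ {x} → Im M x → Im N x) → (∀ {x} → Im N x → Im M x) →
              ∣ det M ∣ ≡ ∣ det N ∣
∣det∣-image {M = M} {N} M-inj N-inj M⊆N N⊆M =
  ℕₚ.≤-antisym (cok-order-≤ {M = M} {N} N⊆M oM oN) (cok-order-≤ {M = N} {M} M⊆N oN oM)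
  where
  oM = FiniteCok.order (finiteCok M M-inj)
  oN = FiniteCok.order (finiteCok N N-inj)

-- Bordered matrices and constant row sums

bordered : ∀ {m} → ℤ → Mat (suc m) → Mat (suc m)
bordered d X i zero    = d
bordered d X i (suc j) = X i (suc j)

-- Replacing the first coordinate by zero expresses the remaining columns through `X` itself, so
-- facts about `X` apply to them.
bordered-· : ∀ {m} d (X : Mat (suc m)) z i → (bordered d X · z) i ≡ d * z zero + (X · (+ 0 ∷ᵛ z ∘ suc)) i
bordered-· d X z i = cong (λ t → d * z zero + t)
  (sym (trans (cong (λ t → t + ∑ (λ j → X i (suc j) * z (suc j))) (ℤₚ.*-zeroʳ (X i zero))) (ℤₚ.+-identityˡ _)))

det-bordered : ∀ {m} d (X : Mat (suc m)) → det (bordered d X) ≡ d * det (bordered (+ 1) X)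
det-bordered d X = trans
  -- Linearity in column zero with second coefficient zero amounts to scaling that column.
  (det-linear zero d (+ 0) (bordered (+ 1) X) (bordered (+ 1) X) (bordered d X)
     (λ r → lemma d) off off)
  (trans (cong (λ t → d * det (bordered (+ 1) X) + t) (ℤₚ.*-zeroˡ (det (bordered (+ 1) X)))) (ℤₚ.+-identityʳ _))
  where
  lemma : ∀ d → d ≡ d * + 1 + + 0 * + 1
  lemma = solve-∀
  off : ∀ r c → c ≢ zero → bordered (+ 1) X r c ≡ bordered d X r c
  off r zero    c≢0 = contradiction refl c≢0
  off r (suc c) c≢0 = refl

·-const : ∀ {m} (X : Mat m) {s} → (∀ i → ∑ (X i) ≡ s) → ∀ c i → (X · (λ _ → c)) i ≡ s * c
·-const X rows c i = trans (∑-*ʳ c (X i)) (cong (_* c) (rows i))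

-- The form in which the maximum principle enters the comparison of determinants; with a nonzero
-- common row sum it yields injectivity.
ConstantPreimages : ∀ {m} → Mat (suc m) → Set
ConstantPreimages X = ∀ u t → (∀ i → (X · u) i ≡ t) → ∀ j → u j ≡ u zero

module Bordered {m} (X : Mat (suc m)) (s : ℤ) (s≢0 : s ≢ + 0) (rows : ∀ i → ∑ (X i) ≡ s)
                (constant : ConstantPreimages X) where

  X-inj : Inj X
  X-inj z Xz≗0 i = trans (z≗ i) (*-≡0 s≢0 (trans (sym (·-const X rows (z zero) zero))
                     (trans (sym (·-congʳ X z≗ zero)) (Xz≗0 zero))))
    where z≗ = constant z (+ 0) Xz≗0

  -- For a kernel vector `z`, `X` maps `+ 0 ∷ᵛ z ∘ suc` to a constant vector. That preimage is then
  -- constant and equal to its first entry zero, which leaves `d * z zero ≡ + 0`.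
  bordered-inj : ∀ d → d ≢ + 0 → Inj (bordered d X)
  bordered-inj d d≢0 z Pz≗0 = λ { zero → z₀≡0 ; (suc j) → tail≗0 (suc j) }
    where
    solve-for : ∀ a b → b ≡ (a + b) - a
    solve-for = solve-∀
    Xtail : ∀ i → (X · (+ 0 ∷ᵛ z ∘ suc)) i ≡ + 0 - d * z zero
    Xtail i = trans (solve-for (d * z zero) _)
                (cong (_- d * z zero) (trans (sym (bordered-· d X z i)) (Pz≗0 i)))
    tail≗0 : ∀ j → (+ 0 ∷ᵛ z ∘ suc) j ≡ + 0
    tail≗0 = constant (+ 0 ∷ᵛ z ∘ suc) (+ 0 - d * z zero) Xtail
    z₀≡0 : z zero ≡ + 0
    z₀≡0 = *-≡0 d≢0 (sym (ℤₚ.i-j≡0⇒i≡j (+ 0) (d * z zero)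
             (trans (sym (Xtail zero)) (trans (·-congʳ X tail≗0 zero) (·-0 X zero)))))

  -- Write `z` as `z zero` times the all-ones vector plus a vector with first entry zero. `X` sends
  -- the all-ones vector to `s` times itself, which is the new column.
  Im-to : ∀ {x} → Im X x → Im (bordered s X) x
  Im-to (z , x≗) = z zero ∷ᵛ (λ j → z (suc j) - z zero) , λ i → trans (x≗ i) (sym (begin
    (bordered s X · (z zero ∷ᵛ (λ j → z (suc j) - z zero))) i  ≡⟨ bordered-· s X (z zero ∷ᵛ (λ j → z (suc j) - z zero)) i ⟩
    s * z zero + (X · (+ 0 ∷ᵛ (λ j → z (suc j) - z zero))) i
      ≡⟨ cong (λ t → s * z zero + t) (·-congʳ X
           {+ 0 ∷ᵛ (λ j → z (suc j) - z zero)} {λ j → + 1 * z j + (- z zero) * + 1}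
           (λ { zero → lemma₀ (z zero) ; (suc j) → lemmaₛ (z (suc j)) (z zero) }) i) ⟩
    s * z zero + (X · (λ j → + 1 * z j + (- z zero) * + 1)) i
      ≡⟨ cong (λ t → s * z zero + t) (·-linear X (+ 1) (- z zero) z (λ _ → + 1) i) ⟩
    s * z zero + (+ 1 * (X · z) i + (- z zero) * (X · (λ _ → + 1)) i)
      ≡⟨ cong (λ t → s * z zero + (+ 1 * (X · z) i + (- z zero) * t)) (·-const X rows (+ 1) i) ⟩
    s * z zero + (+ 1 * (X · z) i + (- z zero) * (s * + 1))    ≡⟨ lemma s (z zero) ((X · z) i) ⟩
    (X · z) i                                                  ∎))
    where
    open ≡-Reasoning
    lemma₀ : ∀ a → + 0 ≡ + 1 * a + (- a) * + 1
    lemma₀ = solve-∀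
    lemmaₛ : ∀ b a → b - a ≡ + 1 * b + (- a) * + 1
    lemmaₛ = solve-∀
    lemma : ∀ s a x → s * a + (+ 1 * x + (- a) * (s * + 1)) ≡ x
    lemma = solve-∀

  Im-from : ∀ {x} → Im (bordered s X) x → Im X x
  Im-from (z , x≗) = Im-linear X (+ 1) (+ 1)
    (λ i → trans (x≗ i) (trans (bordered-· s X z i) (lemma (s * z zero) _)))
    ((λ _ → z zero) , λ i → sym (·-const X rows (z zero) i))
    (+ 0 ∷ᵛ z ∘ suc , λ i → refl)
    where
    lemma : ∀ a b → a + b ≡ + 1 * a + + 1 * b
    lemma = solve-∀

  ∣det∣≡ : ∣ det X ∣ ≡ ∣ s ∣ ℕ.* ∣ det (bordered (+ 1) X) ∣
  ∣det∣≡ = trans (∣det∣-image {M = X} {bordered s X} X-inj (bordered-inj s s≢0) Im-to Im-from)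
    (trans (cong ∣_∣ (det-bordered s X)) (ℤₚ.∣i*j∣≡∣i∣*∣j∣ s (det (bordered (+ 1) X))))

-- Column `j` of `X` is the all-ones vector minus column `j` of `Y`, and the all-ones vector is the
-- border; its coefficient collects the sum of the tail of `z`.
bordered-complement : ∀ {m} (X Y : Mat (suc m)) → (∀ i j → X i j + Y i j ≡ + 1) →
                      ∀ {x} → Im (bordered (+ 1) X) x → Im (bordered (+ 1) Y) x
bordered-complement X Y X+Y≡1 (z , x≗) = (z zero + ∑ (z ∘ suc)) ∷ᵛ (λ j → - z (suc j)) , λ i → trans (x≗ i) (begin
  + 1 * z zero + ∑ (λ j → X i (suc j) * z (suc j))
    ≡⟨ cong (λ t → + 1 * z zero + t) (∑-cong (λ j → trans (lemma (X i (suc j)) (Y i (suc j)) (z (suc j)))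
         (trans (cong (λ t → t * z (suc j) + Y i (suc j) * - z (suc j)) (X+Y≡1 i (suc j)))
                (cong (_+ Y i (suc j) * - z (suc j)) (ℤₚ.*-identityˡ (z (suc j))))))) ⟩
  + 1 * z zero + ∑ (λ j → z (suc j) + Y i (suc j) * - z (suc j))
    ≡⟨ cong (λ t → + 1 * z zero + t) (∑-+ (z ∘ suc) (λ j → Y i (suc j) * - z (suc j))) ⟩
  + 1 * z zero + (∑ (z ∘ suc) + ∑ (λ j → Y i (suc j) * - z (suc j)))
    ≡⟨ assoc (z zero) (∑ (z ∘ suc)) _ ⟩
  + 1 * (z zero + ∑ (z ∘ suc)) + ∑ (λ j → Y i (suc j) * - z (suc j)) ∎)
  where
  open ≡-Reasoning
  lemma : ∀ x y z → x * z ≡ (x + y) * z + y * - z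
  lemma = solve-∀
  assoc : ∀ a b c → + 1 * a + (b + c) ≡ + 1 * (a + b) + c
  assoc = solve-∀

-- Laplacians and cones

∑-mono : ∀ {m} {f g : Fin m → ℤ} → (∀ i → f i ℤ.≤ g i) → ∑ f ℤ.≤ ∑ g
∑-mono {zero}  f≤g = ℤₚ.≤-refl
∑-mono {suc m} f≤g = ℤₚ.+-mono-≤ (f≤g zero) (∑-mono (f≤g ∘ suc))

argmax : ∀ {m} (u : Fin (suc m) → ℤ) → ∃[ i ] (∀ j → u j ℤ.≤ u i)
argmax {zero}  u = zero , λ { zero → ℤₚ.≤-refl }
argmax {suc m} u with argmax (u ∘ suc)
... | i , max with ℤₚ.≤-total (u zero) (u (suc i))
... | inj₁ u₀≤uᵢ = suc i , λ { zero → u₀≤uᵢ ; (suc j) → max j }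
... | inj₂ uᵢ≤u₀ = zero , λ { zero → ℤₚ.≤-refl ; (suc j) → ℤₚ.≤-trans (max j) uᵢ≤u₀ }

δ-sym : ∀ {m} (i j : Fin m) → δ i j ≡ δ j i
δ-sym i j with i ≟ j | j ≟ i
... | yes _   | yes _   = refl
... | yes i≡j | no j≢i  = contradiction (sym i≡j) j≢i
... | no i≢j  | yes j≡i = contradiction (sym j≡i) i≢j
... | no _    | no _    = refl

-- The rows of `Laplacian`, `M`, `C` and of the adjacency matrix of the complete graph all have this
-- shape, so one formula evaluates each product.
∑-affine : ∀ {m} (i : Fin m) a b c (x y u : Fin m → ℤ) → (∀ j → x j ≡ a * δ i j + b * y j + c) →
           ∑ (λ j → x j * u j) ≡ a * u i + b * ∑ (λ j → y j * u j) + c * ∑ u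
∑-affine i a b c x y u x≗ = begin
  ∑ (λ j → x j * u j)
    ≡⟨ ∑-cong (λ j → trans (cong (_* u j) (x≗ j)) (lemma a b c (δ i j) (y j) (u j))) ⟩
  ∑ (λ j → a * (δ i j * u j) + b * (y j * u j) + c * u j)
    ≡⟨ ∑-+ (λ j → a * (δ i j * u j) + b * (y j * u j)) (λ j → c * u j) ⟩
  ∑ (λ j → a * (δ i j * u j) + b * (y j * u j)) + ∑ (λ j → c * u j)
    ≡⟨ cong₂ _+_ (∑-+ (λ j → a * (δ i j * u j)) (λ j → b * (y j * u j))) (∑-*ˡ c u) ⟩
  ∑ (λ j → a * (δ i j * u j)) + ∑ (λ j → b * (y j * u j)) + c * ∑ u
    ≡⟨ cong (_+ c * ∑ u) (cong₂ _+_
         (trans (∑-*ˡ a (λ j → δ i j * u j)) (cong (a *_) (∑-δ i u))) (∑-*ˡ b (λ j → y j * u j))) ⟩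
  a * u i + b * ∑ (λ j → y j * u j) + c * ∑ u ∎
  where
  open ≡-Reasoning
  lemma : ∀ a b c d y u → (a * d + b * y + c) * u ≡ a * (d * u) + b * (y * u) + c * u
  lemma = solve-∀

Laplacian-· : ∀ {m} (A : Digraph m) u i →
              (Laplacian A · u) i ≡ + outdeg A i * u i - ∑ (λ j → + A j i * u j)
Laplacian-· A u i = trans
  (∑-affine i (+ outdeg A i) (- (+ 1)) (+ 0) (Laplacian A i) (λ j → + A j i) u
     (λ j → lemma₁ (+ outdeg A i) (δ i j) (+ A j i)))
  (lemma₂ (+ outdeg A i * u i) _ (∑ u))
  where
  lemma₁ : ∀ o d a → o * d - a ≡ o * d + - (+ 1) * a + + 0
  lemma₁ = solve-∀
  lemma₂ : ∀ x y z → x + - (+ 1) * y + + 0 * z ≡ x - y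
  lemma₂ = solve-∀

-- Column `j` of the Laplacian sums to the outdegree of `j` minus the number of edges leaving `j`;
-- exchanging the two sums exhibits this.
Laplacian-∑ : ∀ {m} (A : Digraph m) u → ∑ (Laplacian A · u) ≡ + 0
Laplacian-∑ A u = begin
  ∑ (Laplacian A · u)                                                     ≡⟨ ∑-cong (Laplacian-· A u) ⟩
  ∑ (λ i → + outdeg A i * u i - ∑ (λ j → + A j i * u j))
    ≡⟨ ∑-− (λ i → + outdeg A i * u i) (λ i → ∑ (λ j → + A j i * u j)) ⟩
  ∑ (λ i → + outdeg A i * u i) - ∑ (λ i → ∑ (λ j → + A j i * u j))
    ≡⟨ cong (λ t → ∑ (λ i → + outdeg A i * u i) - t) (trans (∑-swap (λ i j → + A j i * u j)) (∑-cong (λ j →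
         trans (∑-*ʳ (u j) (λ i → + A j i)) (cong (_* u j) (sym (+∑ℕ (A j))))))) ⟩
  ∑ (λ i → + outdeg A i * u i) - ∑ (λ i → + outdeg A i * u i)             ≡⟨ ℤₚ.+-inverseʳ (∑ (λ i → + outdeg A i * u i)) ⟩
  + 0                                                                     ∎
  where open ≡-Reasoning

+indeg-* : ∀ {m} (A : Digraph m) i c → ∑ (λ j → + A j i * c) ≡ + indeg A i * c
+indeg-* A i c = trans (∑-*ʳ c (λ j → + A j i)) (cong (_* c) (sym (+∑ℕ (λ j → A j i))))

module _ {m} (A : Digraph m) (eulerian : Eulerian A) where

  -- Row sums are outdegree minus indegree, which the Eulerian condition makes zero.
  Laplacian-const : ∀ c i → (Laplacian A · (λ _ → c)) i ≡ + 0
  Laplacian-const c i = trans (Laplacian-· A (λ _ → c) i)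
    (ℤₚ.i≡j⇒i-j≡0 (sym (trans (+indeg-* A i c) (cong (λ o → + o * c) (eulerian i)))))

  -- Bounding the value at every in-neighbour by `u i` turns the adjacency sum into indegree times
  -- `u i`, which is outdegree times `u i`.
  Laplacian-max : ∀ u i → (∀ j → u j ℤ.≤ u i) → + 0 ℤ.≤ (Laplacian A · u) i
  Laplacian-max u i max = subst (+ 0 ℤ.≤_) (sym (Laplacian-· A u i)) (ℤₚ.i≤j⇒0≤j-i (begin
    ∑ (λ j → + A j i * u j)  ≤⟨ ∑-mono (λ j → ℤₚ.*-monoˡ-≤-nonNeg (+ A j i) (max j)) ⟩
    ∑ (λ j → + A j i * u i)  ≡⟨ +indeg-* A i (u i) ⟩
    + indeg A i * u i        ≡⟨ cong (λ o → + o * u i) (eulerian i) ⟩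
    + outdeg A i * u i       ∎))
    where open ℤₚ.≤-Reasoning

-- Maximum principle: at a maximum of u the Laplacian is nonnegative, at a minimum nonpositive.
module _ {m} (A : Digraph (suc m)) (eulerian : Eulerian A) (n : ℕ) where

  resolvent-≤ : ∀ u s → (∀ i → + n * u i + (Laplacian A · u) i ≡ s) → ∀ j → + n * u j ℤ.≤ s
  resolvent-≤ u s eq j with argmax u
  ... | i , max = begin
    + n * u j                          ≤⟨ ℤₚ.*-monoˡ-≤-nonNeg (+ n) (max j) ⟩
    + n * u i                          ≡⟨ ℤₚ.+-identityʳ (+ n * u i) ⟨
    + n * u i + + 0                    ≤⟨ ℤₚ.+-monoʳ-≤ (+ n * u i) (Laplacian-max A eulerian u i max) ⟩
    + n * u i + (Laplacian A · u) i    ≡⟨ eq i ⟩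
    s                                  ∎
    where open ℤₚ.≤-Reasoning

  -- The opposite bound is `resolvent-≤` for the negatives of `u` and `s`.
  resolvent-const : ∀ u s → (∀ i → + n * u i + (Laplacian A · u) i ≡ s) → ∀ j → + n * u j ≡ s
  resolvent-const u s eq j = ℤₚ.≤-antisym (resolvent-≤ u s eq j) (ℤₚ.neg-cancel-≤
    (subst (ℤ._≤ - s) (sym (ℤₚ.neg-distribʳ-* (+ n) (u j))) (resolvent-≤ (λ i → - u i) (- s) neg-eq j)))
    where
    lemma : ∀ n u l → n * - u + - l ≡ - (n * u + l)
    lemma = solve-∀
    neg-eq : ∀ i → + n * - u i + (Laplacian A · (λ j → - u j)) i ≡ - s
    neg-eq i = trans (cong (λ t → + n * - u i + t) (·-neg (Laplacian A) u i))
                 (trans (lemma (+ n) (u i) _) (cong -_ (eq i)))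

-- The Laplacian of a cone

module _ {m} (A : Digraph m) (n : ℕ) where

  cone-ˡˡ : ∀ a b → cone A n (a ↑ˡ n) (b ↑ˡ n) ≡ A a b
  cone-ˡˡ a b rewrite splitAt-↑ˡ m a n | splitAt-↑ˡ m b n = refl

  cone-ˡʳ : ∀ a b → cone A n (a ↑ˡ n) (m ↑ʳ b) ≡ 1
  cone-ˡʳ a b rewrite splitAt-↑ˡ m a n | splitAt-↑ʳ m n b = refl

  cone-ʳˡ : ∀ a b → cone A n (m ↑ʳ a) (b ↑ˡ n) ≡ 1
  cone-ʳˡ a b rewrite splitAt-↑ʳ m n a | splitAt-↑ˡ m b n = refl

  cone-ʳʳ : ∀ a b → + cone A n (m ↑ʳ a) (m ↑ʳ b) ≡ + 1 - δ a b
  cone-ʳʳ a b rewrite splitAt-↑ʳ m n a | splitAt-↑ʳ m n b with a ≟ b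
  ... | yes _ = refl
  ... | no  _ = refl

  ∑-K : ∀ (b : Fin n) w → ∑ (λ c → (+ 1 - δ b c) * w c) ≡ ∑ w - w b
  ∑-K b w = trans (∑-affine b (- (+ 1)) (+ 0) (+ 1) (λ c → + 1 - δ b c) (λ _ → + 0) w (λ c → lemma₁ (δ b c)))
                  (lemma₂ (w b) (∑ (λ c → + 0 * w c)) (∑ w))
    where
    lemma₁ : ∀ d → + 1 - d ≡ - (+ 1) * d + + 0 * + 0 + + 1
    lemma₁ = solve-∀
    lemma₂ : ∀ x y z → - (+ 1) * x + + 0 * y + + 1 * z ≡ z - x
    lemma₂ = solve-∀

  outdeg-coneˡ : ∀ a → + outdeg (cone A n) (a ↑ˡ n) ≡ + outdeg A a + + n
  outdeg-coneˡ a = begin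
    + outdeg (cone A n) (a ↑ˡ n)                  ≡⟨ +∑ℕ (cone A n (a ↑ˡ n)) ⟩
    ∑ (λ v → + cone A n (a ↑ˡ n) v)               ≡⟨ ∑-splitAt m (λ v → + cone A n (a ↑ˡ n) v) ⟩
    ∑ (λ b → + cone A n (a ↑ˡ n) (b ↑ˡ n)) + ∑ (λ b → + cone A n (a ↑ˡ n) (m ↑ʳ b))
      ≡⟨ cong₂ _+_ (trans (∑-cong (λ b → cong +_ (cone-ˡˡ a b))) (sym (+∑ℕ (A a))))
                   (trans (∑-cong (λ b → cong +_ (cone-ˡʳ a b))) (trans (∑-const n (+ 1)) (ℤₚ.*-identityʳ (+ n)))) ⟩
    + outdeg A a + + n                            ∎
    where open ≡-Reasoning

  outdeg-coneʳ : ∀ b → + outdeg (cone A n) (m ↑ʳ b) ≡ + m + (+ n - + 1)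
  outdeg-coneʳ b = begin
    + outdeg (cone A n) (m ↑ʳ b)                  ≡⟨ +∑ℕ (cone A n (m ↑ʳ b)) ⟩
    ∑ (λ v → + cone A n (m ↑ʳ b) v)               ≡⟨ ∑-splitAt m (λ v → + cone A n (m ↑ʳ b) v) ⟩
    ∑ (λ a → + cone A n (m ↑ʳ b) (a ↑ˡ n)) + ∑ (λ c → + cone A n (m ↑ʳ b) (m ↑ʳ c))
      ≡⟨ cong₂ _+_ (trans (∑-cong (λ a → cong +_ (cone-ʳˡ b a))) (trans (∑-const m (+ 1)) (ℤₚ.*-identityʳ (+ m))))
                   (∑-cong (λ c → trans (cone-ʳʳ b c) (sym (ℤₚ.*-identityʳ (+ 1 - δ b c))))) ⟩
    + m + ∑ (λ c → (+ 1 - δ b c) * + 1)           ≡⟨ cong (λ t → + m + t) (∑-K b (λ _ → + 1)) ⟩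
    + m + (∑ {n} (λ _ → + 1) - + 1)
      ≡⟨ cong (λ t → + m + (t - + 1)) (trans (∑-const n (+ 1)) (ℤₚ.*-identityʳ (+ n))) ⟩
    + m + (+ n - + 1)                             ∎
    where open ≡-Reasoning

  -- `u` and `w` are tied to `z` only pointwise, so the formulas serve both for restrictions of a
  -- given `z` and for concatenations `u ++ᵛ w`.
  module _ (z : Fin (m ℕ.+ n) → ℤ) (u : Fin m → ℤ) (w : Fin n → ℤ)
           (z-ˡ : ∀ a → z (a ↑ˡ n) ≡ u a) (z-ʳ : ∀ b → z (m ↑ʳ b) ≡ w b) where

    Laplacian-coneˡ : ∀ a → (Laplacian (cone A n) · z) (a ↑ˡ n) ≡ + n * u a + (Laplacian A · u) a - ∑ w
    Laplacian-coneˡ a = begin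
      (Laplacian (cone A n) · z) (a ↑ˡ n)  ≡⟨ Laplacian-· (cone A n) z (a ↑ˡ n) ⟩
      + outdeg (cone A n) (a ↑ˡ n) * z (a ↑ˡ n) - ∑ (λ v → + cone A n v (a ↑ˡ n) * z v)
        ≡⟨ cong₂ _-_ (cong₂ _*_ (outdeg-coneˡ a) (z-ˡ a)) (trans (∑-splitAt m (λ v → + cone A n v (a ↑ˡ n) * z v)) (cong₂ _+_
             (∑-cong (λ b → cong₂ (λ s t → + s * t) (cone-ˡˡ b a) (z-ˡ b)))
             (∑-cong (λ b → trans (cong₂ (λ s t → + s * t) (cone-ʳˡ b a) (z-ʳ b)) (ℤₚ.*-identityˡ (w b)))))) ⟩
      (+ outdeg A a + + n) * u a - (∑ (λ b → + A b a * u b) + ∑ w)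
        ≡⟨ lemma (+ outdeg A a) (+ n) (u a) (∑ (λ b → + A b a * u b)) (∑ w) ⟩
      + n * u a + (+ outdeg A a * u a - ∑ (λ b → + A b a * u b)) - ∑ w
        ≡⟨ cong (λ t → + n * u a + t - ∑ w) (Laplacian-· A u a) ⟨
      + n * u a + (Laplacian A · u) a - ∑ w ∎
      where
      open ≡-Reasoning
      lemma : ∀ o n u s w → (o + n) * u - (s + w) ≡ n * u + (o * u - s) - w
      lemma = solve-∀

    -- The degree `m + n - 1` rises to `n + m` because `∑ w` also counts the vertex `b`, which is
    -- not its own neighbour.
    Laplacian-coneʳ : ∀ b → (Laplacian (cone A n) · z) (m ↑ʳ b) ≡ + (n ℕ.+ m) * w b - ∑ u - ∑ w
    Laplacian-coneʳ b = begin
      (Laplacian (cone A n) · z) (m ↑ʳ b)  ≡⟨ Laplacian-· (cone A n) z (m ↑ʳ b) ⟩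
      + outdeg (cone A n) (m ↑ʳ b) * z (m ↑ʳ b) - ∑ (λ v → + cone A n v (m ↑ʳ b) * z v)
        ≡⟨ cong₂ _-_ (cong₂ _*_ (outdeg-coneʳ b) (z-ʳ b)) (trans (∑-splitAt m (λ v → + cone A n v (m ↑ʳ b) * z v)) (cong₂ _+_
             (∑-cong (λ a → trans (cong₂ (λ s t → + s * t) (cone-ˡʳ a b) (z-ˡ a)) (ℤₚ.*-identityˡ (u a))))
             (trans (∑-cong (λ c → cong₂ _*_ (trans (cone-ʳʳ c b) (cong (λ d → + 1 - d) (δ-sym c b))) (z-ʳ c))) (∑-K b w)))) ⟩
      (+ m + (+ n - + 1)) * w b - (∑ u + (∑ w - w b))
        ≡⟨ lemma (+ m) (+ n) (w b) (∑ u) (∑ w) ⟩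
      (+ n + + m) * w b - ∑ u - ∑ w       ∎
      where
      open ≡-Reasoning
      lemma : ∀ m n x u w → (m + (n - + 1)) * x - (u + (w - x)) ≡ (n + m) * x - u - w
      lemma = solve-∀

-- The critical group of a cone

-- Transports an enumeration back along an isomorphism. A raw group provides no transitivity, so
-- each hypothesis is phrased with the very relation that the enumeration supplies.
HasOrder-section : ∀ {G H : RawGroup 0ℓ 0ℓ} → let module G = RawGroup G ; module H = RawGroup H in
  (φ : G.Carrier → H.Carrier) (σ : H.Carrier → G.Carrier) →
  (∀ h h′ → σ h G.≈ σ h′ → h H.≈ h′) → (∀ h g → h H.≈ φ g → σ h G.≈ g) →
  ∀ {N} → HasOrder H N → HasOrder G N
HasOrder-section φ σ σ-inj σ-inv (e , e-inj , e-surj) =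
  σ ∘ e , (λ i j p → e-inj i j (σ-inj (e i) (e j) p)) , λ g → let i , p = e-surj (φ g) in i , σ-inv (e i) g p

↑-elim : ∀ m {n} (P : Fin (m ℕ.+ n) → Set) → (∀ a → P (a ↑ˡ n)) → (∀ b → P (m ↑ʳ b)) → ∀ i → P i
↑-elim zero    P l r i       = r i
↑-elim (suc m) P l r zero    = l zero
↑-elim (suc m) P l r (suc i) = ↑-elim m (P ∘ suc) (l ∘ suc) r i

-- The bounds on `k` and `n` become structural: there is a reference vertex `zero`, the complete
-- graph has two distinguished vertices, and `n ∸ 2` reduces to `n′`.
module Cone (k′ n′ : ℕ) (A : Digraph (suc k′)) (eulerian : Eulerian A) where

  k n : ℕ
  k = suc k′
  n = suc (suc n′)

  -- `det C` is `charPolyAt L (- (+ n))` by definition.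
  L M C : Mat k
  L = Laplacian A
  M i j = ((+ n) * δ i j + L i j) + ones i j
  C i j = - (+ n) * δ i j - L i j

  M-· : ∀ u i → (M · u) i ≡ + n * u i + (L · u) i + ∑ u
  M-· u i = trans (∑-affine i (+ n) (+ 1) (+ 1) (M i) (L i) u (λ j → lemma (+ n * δ i j) (L i j)))
                  (sym (lemma′ (+ n * u i) _ (∑ u)))
    where
    lemma : ∀ x y → x + y + + 1 ≡ x + + 1 * y + + 1
    lemma = solve-∀
    lemma′ : ∀ x y z → x + y + z ≡ x + + 1 * y + + 1 * z
    lemma′ = solve-∀

  C-· : ∀ u i → (C · u) i ≡ - (+ n * u i + (L · u) i)
  C-· u i = trans (∑-affine i (- + n) (- (+ 1)) (+ 0) (C i) (L i) u (λ j → lemma (- + n * δ i j) (L i j)))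
                  (lemma′ (+ n) (u i) _ (∑ u))
    where
    lemma : ∀ x y → x - y ≡ x + - (+ 1) * y + + 0
    lemma = solve-∀
    lemma′ : ∀ n u y z → - n * u + - (+ 1) * y + + 0 * z ≡ - (n * u + y)
    lemma′ = solve-∀

  rowSum : ∀ (X : Mat k) i → ∑ (X i) ≡ (X · (λ _ → + 1)) i
  rowSum X i = ∑-cong (λ j → sym (ℤₚ.*-identityʳ (X i j)))

  M-rows : ∀ i → ∑ (M i) ≡ + (n ℕ.+ k)
  M-rows i = begin
    ∑ (M i)                                                    ≡⟨ rowSum M i ⟩
    (M · (λ _ → + 1)) i                                        ≡⟨ M-· (λ _ → + 1) i ⟩
    + n * + 1 + (L · (λ _ → + 1)) i + ∑ {k} (λ _ → + 1)
      ≡⟨ cong₂ (λ s t → + n * + 1 + s + t) (Laplacian-const A eulerian (+ 1) i) (∑-const k (+ 1)) ⟩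
    + n * + 1 + + 0 + + k * + 1                                ≡⟨ lemma (+ n) (+ k) ⟩
    + n + + k                                                  ∎
    where
    open ≡-Reasoning
    lemma : ∀ n k → n * + 1 + + 0 + k * + 1 ≡ n + k
    lemma = solve-∀

  C-rows : ∀ i → ∑ (C i) ≡ - + n
  C-rows i = begin
    ∑ (C i)                                  ≡⟨ rowSum C i ⟩
    (C · (λ _ → + 1)) i                      ≡⟨ C-· (λ _ → + 1) i ⟩
    - (+ n * + 1 + (L · (λ _ → + 1)) i)      ≡⟨ cong (λ t → - (+ n * + 1 + t)) (Laplacian-const A eulerian (+ 1) i) ⟩
    - (+ n * + 1 + + 0)                      ≡⟨ lemma (+ n) ⟩
    - + n                                    ∎
    where
    open ≡-Reasoning
    lemma : ∀ n → - (n * + 1 + + 0) ≡ - n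
    lemma = solve-∀

  resolvent-constant : ∀ u s → (∀ i → + n * u i + (L · u) i ≡ s) → ∀ j → u j ≡ u zero
  resolvent-constant u s eq j = ℤₚ.*-cancelˡ-≡ (+ n) (u j) (u zero)
    (trans (resolvent-const A eulerian n u s eq j) (sym (resolvent-const A eulerian n u s eq zero)))

  -- The all-ones matrix contributes a constant vector with entries `∑ u`, which moves to the
  -- right-hand side and leaves a resolvent equation.
  M-constant : ConstantPreimages M
  M-constant u t Mu≗t = resolvent-constant u (t - ∑ u) (λ i →
    trans (lemma _ (∑ u)) (cong (_- ∑ u) (trans (sym (M-· u i)) (Mu≗t i))))
    where
    lemma : ∀ x y → x ≡ x + y - y
    lemma = solve-∀

  C-constant : ConstantPreimages C
  C-constant u t Cu≗t = resolvent-constant u (- t) (λ i →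
    trans (sym (ℤₚ.neg-involutive _)) (cong -_ (trans (sym (C-· u i)) (Cu≗t i))))

  module BM = Bordered M (+ (n ℕ.+ k)) (λ ()) M-rows M-constant
  module BC = Bordered C (- + n) (λ ()) C-rows C-constant

  M+C≡1 : ∀ i j → M i j + C i j ≡ + 1
  M+C≡1 i j = lemma (+ n) (δ i j) (L i j)
    where
    lemma : ∀ n d l → n * d + l + + 1 + (- n * d - l) ≡ + 1
    lemma = solve-∀

  ∣det∣-bordered : ∣ det (bordered (+ 1) M) ∣ ≡ ∣ det (bordered (+ 1) C) ∣
  ∣det∣-bordered = ∣det∣-image {M = bordered (+ 1) M} {bordered (+ 1) C}
    (BM.bordered-inj (+ 1) (λ ())) (BC.bordered-inj (+ 1) (λ ()))
    (bordered-complement M C M+C≡1)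
    (bordered-complement C M (λ i j → trans (ℤₚ.+-comm (C i j) (M i j)) (M+C≡1 i j)))

  -- The isomorphism for the critical group

  Gn = crit (cone A n)
  S = rawGroup (ZModPow (n ℕ.+ k) n′) (cok M)
  module Gn = RawGroup Gn
  module S = RawGroup S

  q : ℤ
  q = + (n ℕ.+ k)

  -- Both congruences depend only on differences, so they transfer along pointwise equal
  -- differences.
  S-resp : ∀ (x y x′ y′ : S.Carrier) →
           (∀ i → proj₁ x′ i - proj₁ y′ i ≡ proj₁ x i - proj₁ y i) →
           (∀ a → proj₂ x′ a - proj₂ y′ a ≡ proj₂ x a - proj₂ y a) → x S.≈ y → x′ S.≈ y′
  S-resp _ _ _ _ eq₁ eq₂ (p₁ , p₂) =
    (λ i → subst (λ t → n ℕ.+ k ℕ∣.∣ ∣ t ∣) (sym (eq₁ i)) (p₁ i)) , Im-resp M eq₂ p₂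

  φ : Gn.Carrier → S.Carrier
  φ (x , _) = (λ i → x (k ↑ʳ suc (suc i)) - x (k ↑ʳ zero)) , (λ a → x (a ↑ˡ n) - x (k ↑ʳ zero))

  regroup : ∀ a b c d → (a - b) - (c - d) ≡ (a - c) - (b - d)
  regroup = solve-∀

  -- Subtracting the row of vertex zero of the complete graph cancels `∑ w`. A row of that graph
  -- then leaves `q` times a difference of entries of `w`; a row of the base graph leaves `M · u`
  -- minus `w zero` times `M` applied to the all-ones vector.
  φ-cong : ∀ {x y} → x Gn.≈ y → φ x S.≈ φ y
  φ-cong {x , _} {y , _} (z , x-y≗) = divisible , in-image
    where
    u = λ a → z (a ↑ˡ n)
    w = λ b → z (k ↑ʳ b)
    left : ∀ a → x (a ↑ˡ n) - y (a ↑ˡ n) ≡ + n * u a + (L · u) a - ∑ w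
    left a = trans (x-y≗ (a ↑ˡ n)) (Laplacian-coneˡ A n z u w (λ _ → refl) (λ _ → refl) a)
    right : ∀ b → x (k ↑ʳ b) - y (k ↑ʳ b) ≡ q * w b - ∑ u - ∑ w
    right b = trans (x-y≗ (k ↑ʳ b)) (Laplacian-coneʳ A n z u w (λ _ → refl) (λ _ → refl) b)
    factor : ∀ q x y s t → (q * x - s - t) - (q * y - s - t) ≡ q * (x - y)
    factor = solve-∀
    divisible : ∀ i → n ℕ.+ k ℕ∣.∣ ∣ (x (k ↑ʳ suc (suc i)) - x (k ↑ʳ zero)) - (y (k ↑ʳ suc (suc i)) - y (k ↑ʳ zero)) ∣
    divisible i = ≡*⇒∣ {q} {z = w (suc (suc i)) - w zero}
      (trans (regroup (x (k ↑ʳ suc (suc i))) (x (k ↑ʳ zero)) (y (k ↑ʳ suc (suc i))) (y (k ↑ʳ zero)))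
        (trans (cong₂ _-_ (right (suc (suc i))) (right zero))
               (factor q (w (suc (suc i))) (w zero) (∑ u) (∑ w))))
    collect : ∀ q w₀ a s t → (a - t) - (q * w₀ - s - t) ≡ + 1 * (a + s) + (- w₀) * (q * + 1)
    collect = solve-∀
    in-image : Im M (λ a → (x (a ↑ˡ n) - x (k ↑ʳ zero)) - (y (a ↑ˡ n) - y (k ↑ʳ zero)))
    in-image = Im-linear M (+ 1) (- w zero)
      (λ a → trans (regroup (x (a ↑ˡ n)) (x (k ↑ʳ zero)) (y (a ↑ˡ n)) (y (k ↑ʳ zero)))
        (trans (cong₂ _-_ (left a) (right zero)) (collect q (w zero) (+ n * u a + (L · u) a) (∑ u) (∑ w))))
      (u , λ a → sym (M-· u a))
      ((λ _ → + 1) , λ a → sym (·-const M M-rows (+ 1) a))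

  -- The equation for the vertex 1 of Kₙ is implied by the others, because x and y have degree 0.
  φ-injective : ∀ {x y} → φ x S.≈ φ y → x Gn.≈ y
  φ-injective {x , ∑x≡0} {y , ∑y≡0} (divisible , u , in-image) = z , ↑-elim k
    (λ i → d i ≡ (Laplacian (cone A n) · z) i)
    (λ a → trans (left a) (sym (Laplacian-coneˡ A n z u w (lookup-++ˡ u w) (lookup-++ʳ u w) a)))
    (λ b → trans (right b) (sym (Laplacian-coneʳ A n z u w (lookup-++ˡ u w) (lookup-++ʳ u w) b)))
    where
    d : Fin (k ℕ.+ n) → ℤ
    d i = x i - y i
    d₀ = d (k ↑ʳ zero)
    d₁ = d (k ↑ʳ suc zero)
    q∣ : ∀ i → q Signed.∣ (x (k ↑ʳ suc (suc i)) - x (k ↑ʳ zero)) - (y (k ↑ʳ suc (suc i)) - y (k ↑ʳ zero))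
    q∣ i = ∣ᵤ⇒∣ (divisible i)
    ws : Fin n′ → ℤ
    ws i = quotient (q∣ i)
    -- With `w zero` normalised to zero, the equation at vertex zero reads `d₀ ≡ - ∑ u - ∑ w`; this
    -- value of `w₁` is the one that satisfies it.
    w₁ = - (d₀ + ∑ u + ∑ ws)
    w : Fin n → ℤ
    w = + 0 ∷ᵛ w₁ ∷ᵛ ws
    z : Fin (k ℕ.+ n) → ℤ
    z = u ++ᵛ w

    add-back : ∀ a b → a ≡ (a - b) + b
    add-back = solve-∀
    d-ˡ : ∀ a → d (a ↑ˡ n) ≡ (M · u) a + d₀
    d-ˡ a = trans (add-back (d (a ↑ˡ n)) d₀) (cong (_+ d₀)
      (trans (sym (regroup (x (a ↑ˡ n)) (x (k ↑ʳ zero)) (y (a ↑ˡ n)) (y (k ↑ʳ zero)))) (in-image a)))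
    d-ʳ : ∀ i → d (k ↑ʳ suc (suc i)) ≡ q * ws i + d₀
    d-ʳ i = trans (add-back (d (k ↑ʳ suc (suc i))) d₀) (cong (_+ d₀)
      (trans (sym (regroup (x (k ↑ʳ suc (suc i))) (x (k ↑ʳ zero)) (y (k ↑ʳ suc (suc i))) (y (k ↑ʳ zero))))
        (trans (equality (q∣ i)) (ℤₚ.*-comm (ws i) q))))

    ∑-Mu : ∑ (M · u) ≡ q * ∑ u
    ∑-Mu = begin
      ∑ (M · u)                                            ≡⟨ ∑-cong (M-· u) ⟩
      ∑ (λ a → + n * u a + (L · u) a + ∑ u)                ≡⟨ ∑-+ (λ a → + n * u a + (L · u) a) (λ _ → ∑ u) ⟩
      ∑ (λ a → + n * u a + (L · u) a) + ∑ {k} (λ _ → ∑ u)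
        ≡⟨ cong₂ _+_ (∑-+ (λ a → + n * u a) (L · u)) (∑-const k (∑ u)) ⟩
      ∑ (λ a → + n * u a) + ∑ (L · u) + + k * ∑ u
        ≡⟨ cong₂ (λ s t → s + t + + k * ∑ u) (∑-*ˡ (+ n) u) (Laplacian-∑ A u) ⟩
      + n * ∑ u + + 0 + + k * ∑ u                          ≡⟨ lemma (+ n) (+ k) (∑ u) ⟩
      (+ n + + k) * ∑ u                                    ∎
      where
      open ≡-Reasoning
      lemma : ∀ n k s → n * s + + 0 + k * s ≡ (n + k) * s
      lemma = solve-∀

    -- The degree condition on `x` and `y`, with every coordinate except `d₁` expressed through `u`,
    -- `ws` and `d₀`.
    ∑d≡0 : (q * ∑ u + + k * d₀) + (d₀ + (d₁ + (q * ∑ ws + + n′ * d₀))) ≡ + 0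
    ∑d≡0 = begin
      (q * ∑ u + + k * d₀) + (d₀ + (d₁ + (q * ∑ ws + + n′ * d₀)))
        ≡⟨ cong₂ (λ s t → s + (d₀ + (d₁ + t)))
             (trans (∑-cong d-ˡ) (trans (∑-+ (M · u) (λ _ → d₀)) (cong₂ _+_ ∑-Mu (∑-const k d₀))))
             (trans (∑-cong d-ʳ) (trans (∑-+ (λ i → q * ws i) (λ _ → d₀)) (cong₂ _+_ (∑-*ˡ q ws) (∑-const n′ d₀)))) ⟨
      ∑ (λ (a : Fin k) → d (a ↑ˡ n)) + ∑ (λ b → d (k ↑ʳ b))      ≡⟨ ∑-splitAt k d ⟨
      ∑ d                                              ≡⟨ ∑-− x y ⟩
      ∑ x - ∑ y                                        ≡⟨ cong₂ _-_ ∑x≡0 ∑y≡0 ⟩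
      + 0                                              ∎
      where open ≡-Reasoning

    left : ∀ a → d (a ↑ˡ n) ≡ + n * u a + (L · u) a - ∑ w
    left a = trans (d-ˡ a) (trans (cong (_+ d₀) (M-· u a)) (lemma (+ n * u a + (L · u) a) (∑ u) d₀ (∑ ws)))
      where
      lemma : ∀ a s d t → a + s + d ≡ a - (+ 0 + (- (d + s + t) + t))
      lemma = solve-∀

    right : ∀ b → d (k ↑ʳ b) ≡ q * w b - ∑ u - ∑ w
    right zero = lemma q d₀ (∑ u) (∑ ws)
      where
      lemma : ∀ q d s t → d ≡ q * + 0 - s - (+ 0 + (- (d + s + t) + t))
      lemma = solve-∀
    -- The two sides differ by exactly the left-hand side of `∑d≡0`, once `q` is unfolded to
    -- `+ 2 + n′ + k`.
    right (suc zero) = ℤₚ.i-j≡0⇒i≡j d₁ _ (trans (lemma (+ n′) (+ k) d₀ d₁ (∑ u) (∑ ws)) ∑d≡0)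
      where
      lemma : ∀ n′ k d₀ d₁ s t →
        d₁ - ((+ 2 + n′ + k) * - (d₀ + s + t) - s - (+ 0 + (- (d₀ + s + t) + t))) ≡
        ((+ 2 + n′ + k) * s + k * d₀) + (d₀ + (d₁ + ((+ 2 + n′ + k) * t + n′ * d₀)))
      lemma = solve-∀
    right (suc (suc i)) = trans (d-ʳ i) (lemma q d₀ (∑ u) (∑ ws) (ws i))
      where
      lemma : ∀ q d s t x → q * x + d ≡ q * x - s - (+ 0 + (- (d + s + t) + t))
      lemma = solve-∀

  -- A section of `φ`: vertex zero of the complete graph gets the value zero and vertex one absorbs
  -- the degree.
  σ : S.Carrier → Gn.Carrier
  σ (c , e) = e ++ᵛ w , (begin
    ∑ (e ++ᵛ w)                                                        ≡⟨ ∑-splitAt k (e ++ᵛ w) ⟩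
    ∑ (λ (a : Fin k) → (e ++ᵛ w) (a ↑ˡ n)) + ∑ (λ b → (e ++ᵛ w) (k ↑ʳ b))
      ≡⟨ cong₂ _+_ (∑-cong (lookup-++ˡ e w)) (∑-cong (lookup-++ʳ e w)) ⟩
    ∑ e + (+ 0 + (- (∑ e + ∑ c) + ∑ c))                                ≡⟨ lemma (∑ e) (∑ c) ⟩
    + 0                                                                ∎)
    where
    open ≡-Reasoning
    w : Fin n → ℤ
    w = + 0 ∷ᵛ - (∑ e + ∑ c) ∷ᵛ c
    lemma : ∀ s t → s + (+ 0 + (- (s + t) + t)) ≡ + 0
    lemma = solve-∀

  φσ₁ : ∀ s i → proj₁ (φ (σ s)) i ≡ proj₁ s i
  φσ₁ (c , e) i = trans (cong₂ _-_ (lookup-++ʳ e _ (suc (suc i))) (lookup-++ʳ e _ zero)) (ℤₚ.+-identityʳ (c i))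

  φσ₂ : ∀ s a → proj₂ (φ (σ s)) a ≡ proj₂ s a
  φσ₂ (c , e) a = trans (cong₂ _-_ (lookup-++ˡ e _ a) (lookup-++ʳ e _ zero)) (ℤₚ.+-identityʳ (e a))

  σ-injective : ∀ s t → σ s Gn.≈ σ t → s S.≈ t
  σ-injective s t p = S-resp (φ (σ s)) (φ (σ t)) s t
    (λ i → sym (cong₂ _-_ (φσ₁ s i) (φσ₁ t i))) (λ a → sym (cong₂ _-_ (φσ₂ s a) (φσ₂ t a)))
    (φ-cong {σ s} {σ t} p)

  σ-inverse : ∀ s g → s S.≈ φ g → σ s Gn.≈ g
  σ-inverse s g p = φ-injective {σ s} {g} (S-resp s (φ g) (φ (σ s)) (φ g)
    (λ i → cong (_- proj₁ (φ g) i) (φσ₁ s i)) (λ a → cong (_- proj₂ (φ g) a) (φσ₂ s a)) p)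

  S-reflexive : ∀ {x y : S.Carrier} → (∀ i → proj₁ x i ≡ proj₁ y i) → (∀ a → proj₂ x a ≡ proj₂ y a) → x S.≈ y
  S-reflexive eq₁ eq₂ =
    (λ i → subst (λ t → n ℕ.+ k ℕ∣.∣ ∣ t ∣) (sym (ℤₚ.i≡j⇒i-j≡0 (eq₁ i))) ((n ℕ.+ k) ℕ∣.∣0)) ,
    Im-0 M (λ a → ℤₚ.i≡j⇒i-j≡0 (eq₂ a))

  φ-isGroupIsomorphism : GroupMorphisms.IsGroupIsomorphism Gn S φ
  φ-isGroupIsomorphism = record
    { isGroupMonomorphism = record
      { isGroupHomomorphism = record
        { isMonoidHomomorphism = record
          { isMagmaHomomorphism = record
            { isRelHomomorphism = record { cong = λ {x} {y} → φ-cong {x} {y} }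
            ; homo = λ g@(x , _) h@(y , _) → S-reflexive {φ (g Gn.∙ h)} {φ g S.∙ φ h}
                (λ i → +-homo (x (k ↑ʳ suc (suc i))) (y (k ↑ʳ suc (suc i))) (x (k ↑ʳ zero)) (y (k ↑ʳ zero)))
                (λ a → +-homo (x (a ↑ˡ n)) (y (a ↑ˡ n)) (x (k ↑ʳ zero)) (y (k ↑ʳ zero)))
            }
          ; ε-homo = S-reflexive {φ Gn.ε} {S.ε} (λ _ → refl) (λ _ → refl)
          }
        ; ⁻¹-homo = λ g@(x , _) → S-reflexive {φ (g Gn.⁻¹)} {(φ g) S.⁻¹}
            (λ i → neg-homo (x (k ↑ʳ suc (suc i))) (x (k ↑ʳ zero)))
            (λ a → neg-homo (x (a ↑ˡ n)) (x (k ↑ʳ zero)))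
        }
      ; injective = λ {x} {y} → φ-injective {x} {y}
      }
    ; surjective = λ s → σ s , λ {g} g≈σs → S-resp (φ g) (φ (σ s)) (φ g) s
        (λ i → cong (λ t → proj₁ (φ g) i - t) (sym (φσ₁ s i)))
        (λ a → cong (λ t → proj₂ (φ g) a - t) (sym (φσ₂ s a)))
        (φ-cong {g} {σ s} g≈σs)
    }
    where
    +-homo : ∀ x y x₀ y₀ → (x + y) - (x₀ + y₀) ≡ (x - x₀) + (y - y₀)
    +-homo = solve-∀
    neg-homo : ∀ x x₀ → (- x) - (- x₀) ≡ - (x - x₀)
    neg-homo = solve-∀

  -- The cyclic subgroup

  constants : ℤ → Fin k → ℤ
  constants t _ = t

  constants-isGroupMonomorphism : GroupMorphisms.IsGroupMonomorphism (ZMod (n ℕ.+ k)) (cok M) constants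
  constants-isGroupMonomorphism = record
    { isGroupHomomorphism = record
      { isMonoidHomomorphism = record
        { isMagmaHomomorphism = record
          { isRelHomomorphism = record { cong = λ {s} {t} s≈t →
              let d = ∣ᵤ⇒∣ {q} {s - t} s≈t in
              (λ _ → quotient d) , λ i → trans (equality d)
                (trans (ℤₚ.*-comm (quotient d) q) (sym (·-const M M-rows (quotient d) i))) }
          ; homo = λ s t → Im-0 M (λ _ → ℤₚ.+-inverseʳ (s + t))
          }
        ; ε-homo = Im-0 M (λ _ → refl)
        }
      ; ⁻¹-homo = λ t → Im-0 M (λ _ → ℤₚ.+-inverseʳ (- t))
      }
    -- `M · u` is the constant `s - t`, so `u` is constant by `M-constant`, and row zero reads
    -- `s - t ≡ q * u zero`.
    ; injective = λ {s} {t} (u , s-t≗) → ≡*⇒∣ {q} {z = u zero} (trans (s-t≗ zero)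
        (trans (·-congʳ M (M-constant u (s - t) (λ i → sym (s-t≗ i))) zero) (·-const M M-rows (u zero) zero)))
    }

  -- The order of the critical group

  N : ℕ
  N = (n ℕ.+ k) ^ n′ ℕ.* ∣ det M ∣

  Gn-order : HasOrder Gn N
  Gn-order = HasOrder-section {Gn} {S} φ σ σ-injective σ-inverse
    (×-order {ZModPow (n ℕ.+ k) n′} {cok M} (ZModPow-order (n ℕ.+ k) n′) (FiniteCok.order (finiteCok M BM.X-inj)))

  -- The product of `n` and the bordered determinant of `C` is `∣ det C ∣`, while the factor `n + k`
  -- split off from `∣ det M ∣` raises the exponent from `n′` to `n ∸ 1`.
  N*n≡ : N ℕ.* n ≡ ∣ charPolyAt L (- (+ n)) ∣ ℕ.* (n ℕ.+ k) ^ (n ∸ 1)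
  N*n≡ = begin
    (n ℕ.+ k) ^ n′ ℕ.* ∣ det M ∣ ℕ.* n
      ≡⟨ cong (λ t → (n ℕ.+ k) ^ n′ ℕ.* t ℕ.* n) (trans BM.∣det∣≡ (cong ((n ℕ.+ k) ℕ.*_) ∣det∣-bordered)) ⟩
    (n ℕ.+ k) ^ n′ ℕ.* ((n ℕ.+ k) ℕ.* ∣ det (bordered (+ 1) C) ∣) ℕ.* n
      ≡⟨ lemma ((n ℕ.+ k) ^ n′) (n ℕ.+ k) ∣ det (bordered (+ 1) C) ∣ n ⟩
    n ℕ.* ∣ det (bordered (+ 1) C) ∣ ℕ.* (n ℕ.+ k) ^ (n ∸ 1)
      ≡⟨ cong (ℕ._* (n ℕ.+ k) ^ (n ∸ 1)) BC.∣det∣≡ ⟨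
    ∣ det C ∣ ℕ.* (n ℕ.+ k) ^ (n ∸ 1) ∎
    where
    open ≡-Reasoning
    lemma : ∀ p s d n → p ℕ.* (s ℕ.* d) ℕ.* n ≡ n ℕ.* d ℕ.* (s ℕ.* p)
    lemma = ℕSolver.solve-∀

theorem1 : (k : ℕ) → 1 ≤ k → (A : Digraph k) → Eulerian A → Connected A →
    (n : ℕ) → 2 ≤ n →
    let L = Laplacian A
        M : Mat k
        M = λ i j → ((+ n) ℤ.* δ i j ℤ.+ L i j) ℤ.+ ones i j
        Gn = crit (cone A n)
        S = rawGroup (ZModPow (n Data.Nat.+ k) (n ∸ 2)) (cok M)
    in (Σ (RawGroup.Carrier Gn → RawGroup.Carrier S) (GroupMorphisms.IsGroupIsomorphism Gn S))
       × (Σ (RawGroup.Carrier (ZMod (n Data.Nat.+ k)) → RawGroup.Carrier (cok M))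
            (GroupMorphisms.IsGroupMonomorphism (ZMod (n Data.Nat.+ k)) (cok M)))
       × (∃[ N ] (HasOrder Gn N × N Data.Nat.* n ≡ ∣ charPolyAt L (- (+ n)) ∣ Data.Nat.* (n Data.Nat.+ k) ^ (n ∸ 1)))
theorem1 (suc k′) _ A eulerian _ (suc (suc n′)) _ =
  (φ , φ-isGroupIsomorphism) , (constants , constants-isGroupMonomorphism) , (N , Gn-order , N*n≡)
  where open Cone k′ n′ A eulerian
theorem1 (suc k′) _ A eulerian _ (suc zero) (s≤s ())
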